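{- The following hold. (1) $|S_n(12\text{ - }3,1\text{ - }23,31\text{ - }2,3\text{ - }12)|=1+\binom{n}{2}$ for every $n\ge1$. (2) $|S_n(1\text{ - }23,21\text{ - }3,1\text{ - }32,12\text{ - }3)|=\binom{n}{\lceil n/2\rceil}$ for every $n\ge1$. (3) $|S_n(1\text{ - }23,23\text{ - }1,3\text{ - }12,12\text{ - }3)|=2^{n-2}+1$ for every $n\ge2$. (4) $|S_n(12\text{ - }3,2\text{ - }13,32\text{ - }1,21\text{ - }3)|=3$ for every $n\ge3$.
   Context: $S_n$ is the set of permutations $\pi=\pi_1\pi_2\cdots\pi_n$ of $\{1,\dots,n\}$. For $abc$ a permutation of $123$, the generalized pattern $a\text{ - }bc$ is contained in $\pi$ if there are indices $i<j$ with $j+1\le n$ such that $\pi_i\pi_j\pi_{j+1}$ is order-isomorphic to $abc$; the generalized pattern $ab\text{ - }c$ is contained in $\pi$ if there are indices $i,k$ with $i+1<k\le n$ such that $\pi_i\pi_{i+1}\pi_k$ is order-isomorphic to $abc$. (Letters not separated by a dash must occur in adjacent positions; letters separated by a dash need not be adjacent.) $\pi$ avoids a pattern if it does not contain it. $S_n(p_1,\dots,p_m)$ is the set of $\pi\in S_n$ avoiding all of $p_1,\dots,p_m$. -}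

module Defs where

open import Data.Fin.Base using (Fin; toℕ)
open import Data.Fin.Permutation using (Permutation′; _⟨$⟩ʳ_)
open import Data.List.Base using (List)
open import Data.List.Relation.Unary.All using (All)
open import Data.Nat.Base using (ℕ; suc; _<_)
open import Data.Product.Base using (Σ-syntax; ∃-syntax; _×_; proj₁)
open import Data.Vec.Base using (Vec; []; _∷_; lookup)
open import Function.Bundles using (_⇔_; Inverse)
open import Level using (0ℓ)
open import Relation.Binary.Bundles using (Setoid)
open import Relation.Binary.PropositionalEquality using (_≡_; _→-setoid_; setoid)
open import Relation.Nullary.Negation using (¬_)
import Relation.Binary.Construct.On as On

-- Generalized patterns of length three: ⟨ a - b ∙ c ⟩ is "a-bc" and
-- ⟨ a ∙ b - c ⟩ is "ab-c".  They are only meant to be used with abc a permutation of 123.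
data Pattern : Set where
  ⟨_-_∙_⟩ : (a b c : ℕ) → Pattern
  ⟨_∙_-_⟩ : (a b c : ℕ) → Pattern

OrderIsomorphic : ∀ {k} → Vec ℕ k → Vec ℕ k → Set
OrderIsomorphic u v = ∀ s t → lookup u s < lookup u t ⇔ lookup v s < lookup v t

-- Positions and letters are both numbered from 0 (they live in Fin n) rather
-- than from 1; the conditions below are invariant under this shift.
letter : ∀ {n} → Permutation′ n → Fin n → ℕ
letter π i = toℕ (π ⟨$⟩ʳ i)

Contains : ∀ {n} → Permutation′ n → Pattern → Set
Contains π ⟨ a - b ∙ c ⟩ =
  ∃[ i ] ∃[ j ] ∃[ j′ ]
    toℕ i < toℕ j × toℕ j′ ≡ suc (toℕ j) ×
    OrderIsomorphic (letter π i ∷ letter π j ∷ letter π j′ ∷ []) (a ∷ b ∷ c ∷ [])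
Contains π ⟨ a ∙ b - c ⟩ =
  ∃[ i ] ∃[ i′ ] ∃[ k ]
    toℕ i′ ≡ suc (toℕ i) × toℕ i′ < toℕ k ×
    OrderIsomorphic (letter π i ∷ letter π i′ ∷ letter π k ∷ []) (a ∷ b ∷ c ∷ [])

Avoids : ∀ {n} → Permutation′ n → Pattern → Set
Avoids π p = ¬ Contains π p

-- S n ps is the set S_n(p₁,…,p_m).  Two elements are equal when their
-- permutations agree pointwise: the proofs stored in a Permutation′ and the
-- avoidance proofs must not be counted.
S : ℕ → List Pattern → Setoid 0ℓ 0ℓ
S n ps = On.setoid {B = Σ[ π ∈ Permutation′ n ] All (Avoids π) ps}
                   (Fin n →-setoid Fin n) (λ σ → proj₁ σ ⟨$⟩ʳ_)

infix 4 ∣_∣≡_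

∣_∣≡_ : Setoid 0ℓ 0ℓ → ℕ → Set
∣ A ∣≡ k = Inverse A (setoid (Fin k))

{-# OPTIONS --safe #-}
-- Deleting the first letter preserves avoidance, so the avoiders form a generating
-- tree in which the children of π are the words x π′ with no forbidden occurrence
-- starting at x.  In each of the four classes the admissible x depend only on a small
-- label of π, and the numbers of descendants satisfy a recursion on labels:
-- (1) the decreasing word of length N has one decreasing child and N children with an
--     ascent, and the latter have exactly one child each;
-- (2) if π begins with its maximum and k + 1 letters may be prepended, the number of
--     m-th generation descendants is binom(k + m, ⌈m/2⌉);
-- (3) a word with an ascent to which k + 1 letters may be prepended has binom(k + m, m)
--     m-th generation descendants, and these add up to a row of Pascal's triangle;
-- (4) the rules are low → high, high → low + stuck, and stuck words have no children.
module Submission where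

open import Defs
open import Data.Empty using (⊥)
open import Data.Fin.Base using (Fin; zero; suc; toℕ; fromℕ<; inject₁; punchIn)
open import Data.Fin.Patterns using (0F; 1F; 2F)
open import Data.Fin.Permutation as Perm using (Permutation′; _⟨$⟩ʳ_; _⟨$⟩ˡ_; insert; remove)
open import Data.Fin.Properties using (toℕ-injective; toℕ-fromℕ<; toℕ<n; toℕ-inject₁; punchIn-injective)
open import Data.List.Base using (List; []; _∷_; map; concatMap; length; lookup; _++_)
open import Data.List.Membership.Propositional using (_∈_)
open import Data.List.Membership.Propositional.Properties using (∈-lookup)
open import Data.List.Properties using (map-++; map-cong)
open import Data.List.Relation.Unary.All as All using (All; []; _∷_)
import Data.List.Relation.Unary.All.Properties as Allₚ
open import Data.List.Relation.Unary.AllPairs as AllPairs using (AllPairs; []; _∷_)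
import Data.List.Relation.Unary.AllPairs.Properties as AllPairsₚ
open import Data.List.Relation.Unary.Any as Any using (Any; here; there; index)
import Data.List.Relation.Unary.Any.Properties as Anyₚ
open import Data.List.Relation.Unary.Unique.Propositional using (Unique)
open import Data.Nat.Base using (ℕ; zero; suc; _+_; _∸_; _^_; _≤_; _<_; _≥_; z≤n; s≤s; s≤s⁻¹; ⌈_/2⌉; ⌊_/2⌋)
open import Data.Nat.Combinatorics using (_C_; nC1≡n; nCn≡1; nCk≡nC[n∸k]; k>n⇒nCk≡0; nCk+nC[k+1]≡[n+1]C[k+1])
open import Data.Nat.ListAction using (sum)
open import Data.Nat.ListAction.Properties using (sum-++)
open import Data.Nat.Properties
open import Data.Product.Base using (Σ; ∃-syntax; _×_; _,_; proj₁; proj₂; uncurry)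
open import Data.Sum.Base using (_⊎_; inj₁; inj₂)
open import Data.Vec.Base as Vec using (Vec; []; _∷_)
open import Data.Vec.Properties using (lookup-map)
open import Algebra.Properties.CommutativeSemigroup +-commutativeSemigroup using (interchange; x∙yz≈y∙xz)
open import Function.Base using (_∘_; const)
open import Function.Bundles using (_⇔_; mk⇔; module Equivalence)
open import Relation.Binary.Definitions using (tri<; tri≈; tri>)
open import Relation.Binary.PropositionalEquality
open import Relation.Nullary.Negation using (¬_; contradiction)

open Equivalence using (to; from)

-- Order isomorphism with a permutation of 123

-- Being order isomorphic survives any reindexing of the positions, so only the increasing triple
-- needs a case check; `OrderIsomorphic-sorted` then reaches all six patterns, `σ` being the pattern
-- with its letters counted from 0.
OrderIsomorphic-map : ∀ {k l} (u v : Vec ℕ k) (σ : Vec (Fin k) l) → OrderIsomorphic u v →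
  OrderIsomorphic (Vec.map (Vec.lookup u) σ) (Vec.map (Vec.lookup v) σ)
OrderIsomorphic-map u v σ oi s t
  rewrite lookup-map s (Vec.lookup u) σ | lookup-map t (Vec.lookup u) σ
        | lookup-map s (Vec.lookup v) σ | lookup-map t (Vec.lookup v) σ
  = oi (Vec.lookup σ s) (Vec.lookup σ t)

OrderIsomorphic-123 : ∀ {x y z} → x < y → y < z →
  OrderIsomorphic (x ∷ y ∷ z ∷ []) (1 ∷ 2 ∷ 3 ∷ [])
OrderIsomorphic-123 x<y y<z 0F 0F = mk⇔ (λ p → contradiction p (<-irrefl refl)) λ { (s≤s ()) }
OrderIsomorphic-123 x<y y<z 0F 1F = mk⇔ (const (n<1+n 1)) (const x<y)
OrderIsomorphic-123 x<y y<z 0F 2F = mk⇔ (const (s≤s (s≤s z≤n))) (const (<-trans x<y y<z))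
OrderIsomorphic-123 x<y y<z 1F 0F = mk⇔ (λ p → contradiction p (<-asym x<y)) λ { (s≤s ()) }
OrderIsomorphic-123 x<y y<z 1F 1F = mk⇔ (λ p → contradiction p (<-irrefl refl)) λ { (s≤s (s≤s ())) }
OrderIsomorphic-123 x<y y<z 1F 2F = mk⇔ (const (n<1+n 2)) (const y<z)
OrderIsomorphic-123 x<y y<z 2F 0F = mk⇔ (λ p → contradiction p (<-asym (<-trans x<y y<z))) λ { (s≤s ()) }
OrderIsomorphic-123 x<y y<z 2F 1F = mk⇔ (λ p → contradiction p (<-asym y<z)) λ { (s≤s (s≤s ())) }
OrderIsomorphic-123 x<y y<z 2F 2F = mk⇔ (λ p → contradiction p (<-irrefl refl)) λ { (s≤s (s≤s (s≤s ()))) }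

OrderIsomorphic-sorted : ∀ {x y z} (σ : Vec (Fin 3) 3) → x < y → y < z →
  OrderIsomorphic (Vec.map (Vec.lookup (x ∷ y ∷ z ∷ [])) σ) (Vec.map (Vec.lookup (1 ∷ 2 ∷ 3 ∷ [])) σ)
OrderIsomorphic-sorted σ x<y y<z = OrderIsomorphic-map (_ ∷ _ ∷ _ ∷ []) (1 ∷ 2 ∷ 3 ∷ []) σ (OrderIsomorphic-123 x<y y<z)

-- Comparing an inserted value with the relabelled old ones

punchIn-< : ∀ {n} {x : Fin (suc n)} {y : Fin n} → toℕ y < toℕ x → toℕ (punchIn x y) ≡ toℕ y
punchIn-< {x = suc x} {zero}  _         = refl
punchIn-< {x = suc x} {suc y} (s≤s y<x) = cong suc (punchIn-< y<x)

punchIn-≥ : ∀ {n} {x : Fin (suc n)} {y : Fin n} → toℕ x ≤ toℕ y → toℕ (punchIn x y) ≡ suc (toℕ y)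
punchIn-≥ {x = zero}          _         = refl
punchIn-≥ {x = suc x} {suc y} (s≤s x≤y) = cong suc (punchIn-≥ x≤y)

module _ {n} {x : Fin (suc n)} {y : Fin n} where

  -- The inequality on the right is weak because an old letter equal to `x` makes room by moving up
  -- to `x + 1`.
  punchIn>x : toℕ x < toℕ (punchIn x y) ⇔ toℕ x ≤ toℕ y
  punchIn>x = mk⇔
    (λ x<p → ≮⇒≥ λ y<x → <-asym y<x (subst (toℕ x <_) (punchIn-< y<x) x<p))
    (λ x≤y → subst (toℕ x <_) (sym (punchIn-≥ x≤y)) (s≤s x≤y))

  punchIn<x : toℕ (punchIn x y) < toℕ x ⇔ toℕ y < toℕ x
  punchIn<x = mk⇔
    (λ p<x → ≰⇒> λ x≤y → <-asym p<x (from punchIn>x x≤y))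
    (λ y<x → subst (_< toℕ x) (sym (punchIn-< y<x)) y<x)

punchIn-mono-<⇔ : ∀ {n} {x : Fin (suc n)} {y z : Fin n} →
  toℕ (punchIn x y) < toℕ (punchIn x z) ⇔ toℕ y < toℕ z
punchIn-mono-<⇔ {x = zero}                    = mk⇔ s≤s⁻¹ s≤s
punchIn-mono-<⇔ {x = suc x} {zero}  {zero}    = mk⇔ (λ ()) (λ ())
punchIn-mono-<⇔ {x = suc x} {zero}  {suc z}   = mk⇔ (const (s≤s z≤n)) (const (s≤s z≤n))
punchIn-mono-<⇔ {x = suc x} {suc y} {zero}    = mk⇔ (λ ()) (λ ())
punchIn-mono-<⇔ {x = suc x} {suc y} {suc z}   =
  mk⇔ (s≤s ∘ to punchIn-mono-<⇔ ∘ s≤s⁻¹) (s≤s ∘ from punchIn-mono-<⇔ ∘ s≤s⁻¹)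

module _ {n} {x : Fin (suc n)} {y z : Fin n} where

  private
    Occurrence : Vec ℕ 3 → Set
    Occurrence = OrderIsomorphic (toℕ x ∷ toℕ (punchIn x y) ∷ toℕ (punchIn x z) ∷ [])

  -- Here and in the five analogues, the right side lists the two consecutive inequalities of the
  -- pattern read in increasing order, expressed in old letters. The third inequality follows by
  -- transitivity.
  occurs-123 : Occurrence (1 ∷ 2 ∷ 3 ∷ []) ⇔ (toℕ x ≤ toℕ y × toℕ y < toℕ z)
  occurs-123 = mk⇔
    (λ o → to punchIn>x (from (o 0F 1F) (n<1+n 1)) , to punchIn-mono-<⇔ (from (o 1F 2F) (n<1+n 2)))
    (λ (p , q) → OrderIsomorphic-sorted (0F ∷ 1F ∷ 2F ∷ []) (from punchIn>x p) (from punchIn-mono-<⇔ q))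

  occurs-132 : Occurrence (1 ∷ 3 ∷ 2 ∷ []) ⇔ (toℕ x ≤ toℕ z × toℕ z < toℕ y)
  occurs-132 = mk⇔
    (λ o → to punchIn>x (from (o 0F 2F) (n<1+n 1)) , to punchIn-mono-<⇔ (from (o 2F 1F) (n<1+n 2)))
    (λ (p , q) → OrderIsomorphic-sorted (0F ∷ 2F ∷ 1F ∷ []) (from punchIn>x p) (from punchIn-mono-<⇔ q))

  occurs-213 : Occurrence (2 ∷ 1 ∷ 3 ∷ []) ⇔ (toℕ y < toℕ x × toℕ x ≤ toℕ z)
  occurs-213 = mk⇔
    (λ o → to punchIn<x (from (o 1F 0F) (n<1+n 1)) , to punchIn>x (from (o 0F 2F) (n<1+n 2)))
    (λ (p , q) → OrderIsomorphic-sorted (1F ∷ 0F ∷ 2F ∷ []) (from punchIn<x p) (from punchIn>x q))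

  occurs-231 : Occurrence (2 ∷ 3 ∷ 1 ∷ []) ⇔ (toℕ z < toℕ x × toℕ x ≤ toℕ y)
  occurs-231 = mk⇔
    (λ o → to punchIn<x (from (o 2F 0F) (n<1+n 1)) , to punchIn>x (from (o 0F 1F) (n<1+n 2)))
    (λ (p , q) → OrderIsomorphic-sorted (1F ∷ 2F ∷ 0F ∷ []) (from punchIn<x p) (from punchIn>x q))

  occurs-312 : Occurrence (3 ∷ 1 ∷ 2 ∷ []) ⇔ (toℕ y < toℕ z × toℕ z < toℕ x)
  occurs-312 = mk⇔
    (λ o → to punchIn-mono-<⇔ (from (o 1F 2F) (n<1+n 1)) , to punchIn<x (from (o 2F 0F) (n<1+n 2)))
    (λ (p , q) → OrderIsomorphic-sorted (2F ∷ 0F ∷ 1F ∷ []) (from punchIn-mono-<⇔ p) (from punchIn<x q))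

  occurs-321 : Occurrence (3 ∷ 2 ∷ 1 ∷ []) ⇔ (toℕ z < toℕ y × toℕ y < toℕ x)
  occurs-321 = mk⇔
    (λ o → to punchIn-mono-<⇔ (from (o 2F 1F) (n<1+n 1)) , to punchIn<x (from (o 1F 0F) (n<1+n 2)))
    (λ (p , q) → OrderIsomorphic-sorted (2F ∷ 1F ∷ 0F ∷ []) (from punchIn-mono-<⇔ p) (from punchIn<x q))

-- Prepending a letter

infixr 5 _▸_

_▸_ : ∀ {n} → Fin (suc n) → Permutation′ n → Permutation′ (suc n)
_▸_ = insert zero

-- Adjacency and the order of the positions are built into the indices `inject₁ j`, `suc j` and
-- `suc (suc k)`, so an occurrence at the start carries no position proofs.
ContainsAtStart : ∀ {n} → Permutation′ (suc (suc n)) → Pattern → Set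
ContainsAtStart {n} π ⟨ a - b ∙ c ⟩ = ∃[ j ]
  OrderIsomorphic (letter π zero ∷ letter π (suc (inject₁ j)) ∷ letter π (suc (suc j)) ∷ []) (a ∷ b ∷ c ∷ [])
ContainsAtStart {n} π ⟨ a ∙ b - c ⟩ = ∃[ k ]
  OrderIsomorphic (letter π zero ∷ letter π (suc zero) ∷ letter π (suc (suc k)) ∷ []) (a ∷ b ∷ c ∷ [])

contains-start : ∀ {n} (π : Permutation′ (suc (suc n))) p → ContainsAtStart π p → Contains π p
contains-start π ⟨ a - b ∙ c ⟩ (j , o) =
  zero , suc (inject₁ j) , suc (suc j) , s≤s z≤n , cong (λ m → suc (suc m)) (sym (toℕ-inject₁ j)) , o
contains-start π ⟨ a ∙ b - c ⟩ (k , o) =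
  zero , suc zero , suc (suc k) , refl , s≤s (s≤s z≤n) , o

module _ {n} (x : Fin (suc n)) (π : Permutation′ n) {k} (is : Vec (Fin n) k) (v : Vec ℕ k) where

  private
    w  = Vec.map (letter π) is
    w′ = Vec.map (letter (x ▸ π) ∘ suc) is

    order : ∀ s t → Vec.lookup w′ s < Vec.lookup w′ t ⇔ Vec.lookup w s < Vec.lookup w t
    order s t
      rewrite lookup-map s (letter (x ▸ π) ∘ suc) is | lookup-map t (letter (x ▸ π) ∘ suc) is
            | lookup-map s (letter π) is | lookup-map t (letter π) is
      = punchIn-mono-<⇔

  ▸-OrderIsomorphic⁺ : OrderIsomorphic w v → OrderIsomorphic w′ v
  ▸-OrderIsomorphic⁺ o s t = mk⇔ (to (o s t) ∘ to (order s t)) (from (order s t) ∘ from (o s t))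

  ▸-OrderIsomorphic⁻ : OrderIsomorphic w′ v → OrderIsomorphic w v
  ▸-OrderIsomorphic⁻ o s t = mk⇔ (to (o s t) ∘ from (order s t)) (to (order s t) ∘ from (o s t))

contains-▸ : ∀ {n} (x : Fin (suc n)) (π : Permutation′ n) p → Contains π p → Contains (x ▸ π) p
contains-▸ x π ⟨ a - b ∙ c ⟩ (i , j , k , i<j , k≡1+j , o) =
  suc i , suc j , suc k , s≤s i<j , cong suc k≡1+j , ▸-OrderIsomorphic⁺ x π (i ∷ j ∷ k ∷ []) (a ∷ b ∷ c ∷ []) o
contains-▸ x π ⟨ a ∙ b - c ⟩ (i , j , k , j≡1+i , j<k , o) =
  suc i , suc j , suc k , cong suc j≡1+i , s≤s j<k , ▸-OrderIsomorphic⁺ x π (i ∷ j ∷ k ∷ []) (a ∷ b ∷ c ∷ []) o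

-- An occurrence either uses the first position, and is then an occurrence at the start, or lies
-- entirely within `π`, since `punchIn x` preserves the relative order of the old letters.
avoids-▸ : ∀ {n} (x : Fin (suc (suc n))) (π : Permutation′ (suc n)) p →
  Avoids π p → ¬ ContainsAtStart (x ▸ π) p → Avoids (x ▸ π) p
avoids-▸ x π ⟨ a - b ∙ c ⟩ av ¬st (zero , suc j , suc (suc k) , _ , 2+k≡2+j , o)
  -- Adjacency of the last two positions identifies `j` with `inject₁ k`, the form that
  -- `ContainsAtStart` expects.
  rewrite toℕ-injective {i = j} {j = inject₁ k}
            (trans (sym (suc-injective (suc-injective 2+k≡2+j))) (sym (toℕ-inject₁ k)))
  = ¬st (k , o)
avoids-▸ x π ⟨ a - b ∙ c ⟩ av ¬st (suc i , suc j , suc k , i<j , k≡1+j , o) =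
  av (i , j , k , s≤s⁻¹ i<j , suc-injective k≡1+j , ▸-OrderIsomorphic⁻ x π (i ∷ j ∷ k ∷ []) (a ∷ b ∷ c ∷ []) o)
avoids-▸ x π ⟨ a ∙ b - c ⟩ av ¬st (zero , suc zero , suc (suc k) , _ , _ , o) = ¬st (k , o)
avoids-▸ x π ⟨ a ∙ b - c ⟩ av ¬st (zero , suc zero , suc zero , _ , s≤s () , o)
avoids-▸ x π ⟨ a ∙ b - c ⟩ av ¬st (zero , suc (suc j) , _ , () , _)
avoids-▸ x π ⟨ a ∙ b - c ⟩ av ¬st (suc i , suc j , suc k , j≡1+i , j<k , o) =
  av (i , j , k , suc-injective j≡1+i , s≤s⁻¹ j<k , ▸-OrderIsomorphic⁻ x π (i ∷ j ∷ k ∷ []) (a ∷ b ∷ c ∷ []) o)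

-- Deleting a letter and inserting it again returns a permutation that agrees with the original only
-- pointwise, so avoidance has to be transported along `≈`.
avoids-resp-≈ : ∀ {n} {π ρ : Permutation′ n} → π Perm.≈ ρ → ∀ p → Avoids π p → Avoids ρ p
avoids-resp-≈ π≈ρ ⟨ a - b ∙ c ⟩ av (i , j , k , i<j , k≡1+j , o)
  rewrite sym (π≈ρ i) | sym (π≈ρ j) | sym (π≈ρ k) = av (i , j , k , i<j , k≡1+j , o)
avoids-resp-≈ π≈ρ ⟨ a ∙ b - c ⟩ av (i , j , k , j≡1+i , j<k , o)
  rewrite sym (π≈ρ i) | sym (π≈ρ j) | sym (π≈ρ k) = av (i , j , k , j≡1+i , j<k , o)

avoids-singleton : (π : Permutation′ 1) → ∀ p → Avoids π p
avoids-singleton π ⟨ a - b ∙ c ⟩ (zero , zero , _ , () , _)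
avoids-singleton π ⟨ a ∙ b - c ⟩ (zero , zero , _ , () , _)

▸-cong : ∀ {n} (x : Fin (suc n)) {π ρ : Permutation′ n} → π Perm.≈ ρ → (x ▸ π) Perm.≈ (x ▸ ρ)
▸-cong x π≈ρ zero    = refl
▸-cong x π≈ρ (suc i) = cong (punchIn x) (π≈ρ i)

▸-injectiveʳ : ∀ {n} {x y : Fin (suc n)} {π ρ : Permutation′ n} → (x ▸ π) Perm.≈ (y ▸ ρ) → π Perm.≈ ρ
▸-injectiveʳ {x = x} {ρ = ρ} eq i =
  punchIn-injective x _ _ (trans (eq (suc i)) (cong (λ z → punchIn z (ρ ⟨$⟩ʳ i)) (sym (eq zero))))

-- For an avoider `π` this is exactly what makes `x ▸ π` an avoider again.
Fresh : ∀ {n} → List Pattern → Fin (suc (suc n)) → Permutation′ (suc n) → Set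
Fresh ps x π = All (λ p → ¬ ContainsAtStart (x ▸ π) p) ps

avoids-all-▸ : ∀ {n} {x : Fin (suc (suc n))} {π : Permutation′ (suc n)} ps →
  All (Avoids π) ps → Fresh ps x π → All (Avoids (x ▸ π)) ps
avoids-all-▸ {x = x} {π} ps av fr = All.zipWith (λ {p} → uncurry (avoids-▸ x π p)) (av , fr)

-- Lists of pairwise inequivalent elements and sums over concatenations

lookup-injective : ∀ {a ℓ} {A : Set a} {R : A → A → Set ℓ} {xs} → (∀ {x y} → R x y → R y x) →
  AllPairs (λ x y → ¬ R x y) xs → ∀ i j → R (lookup xs i) (lookup xs j) → i ≡ j
lookup-injective Rsym (_  ∷ _)  zero    zero    _ = refl
lookup-injective Rsym (≁s ∷ _)  zero    (suc j) r = contradiction r (All.lookup ≁s (∈-lookup j))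
lookup-injective Rsym (≁s ∷ _)  (suc i) zero    r = contradiction (Rsym r) (All.lookup ≁s (∈-lookup i))
lookup-injective Rsym (_  ∷ !s) (suc i) (suc j) r = cong suc (lookup-injective Rsym !s i j r)

sum-map-concatMap : ∀ {a b} {A : Set a} {B : Set b} (f : B → ℕ) (g : A → List B) xs →
  sum (map f (concatMap g xs)) ≡ sum (map (λ x → sum (map f (g x))) xs)
sum-map-concatMap f g []       = refl
sum-map-concatMap f g (x ∷ xs) = begin
  sum (map f (g x ++ concatMap g xs))                ≡⟨ cong sum (map-++ f (g x) _) ⟩
  sum (map f (g x) ++ map f (concatMap g xs))        ≡⟨ sum-++ (map f (g x)) _ ⟩
  sum (map f (g x)) + sum (map f (concatMap g xs))   ≡⟨ cong (_ +_) (sum-map-concatMap f g xs) ⟩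
  sum (map f (g x)) + sum (map _ xs)                 ∎
  where open ≡-Reasoning

-- Generating trees

module _ {State : Set} (ps : List Pattern) (Inv : State → ∀ {n} → Permutation′ (suc n) → Set) where

  -- The new letter is a bare number with a bound rather than an element of `Fin`, so that the list
  -- of children can depend on the label alone and not on the length.
  Sprout : ∀ {n} → Permutation′ (suc n) → ℕ × State → Set
  Sprout {n} π (ℓ , t) = ℓ ≤ suc n × (∀ x → toℕ x ≡ ℓ → Fresh ps x π × Inv t (x ▸ π))

-- `sound` says that each listed letter gives an avoider with the promised label, `complete` that no
-- admissible letter is missed, and `unique` that none is listed twice. Together they reduce
-- counting avoiders to a recursion on labels.
module GeneratingTree
  (ps : List Pattern) {State : Set} (children : State → List (ℕ × State))
  (Inv : State → ∀ {n} → Permutation′ (suc n) → Set)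
  (sound : ∀ s {n} {π : Permutation′ (suc n)} → Inv s π →
    All (Sprout ps Inv π) (children s))
  (complete : ∀ s {n} {π : Permutation′ (suc n)} → Inv s π → ∀ x → Fresh ps x π →
    toℕ x ∈ map proj₁ (children s))
  (unique : ∀ s → Unique (map proj₁ (children s)))
  (root : State) (inv-root : Inv root {0} Perm.id)
  where

  -- The number of descendants, `m` generations down, of any node labelled `s`.
  leaves : ℕ → State → ℕ
  leaves zero    s = 1
  leaves (suc m) s = sum (map (leaves m ∘ proj₂) (children s))

  -- Generation `n` consists of words of length `n + 1`, because the root is the one-letter word.
  record Node (n : ℕ) : Set where
    field
      perm   : Permutation′ (suc n)
      avoids : All (Avoids perm) ps
      state  : State
      inv    : Inv state perm

  open Node

  module _ {n} (ν : Node n) where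

    sprout : ∀ {c} → Sprout ps Inv (perm ν) c → Node (suc n)
    sprout {ℓ , t} (ℓ≤1+n , grow) = record
      { perm   = x ▸ perm ν
      ; avoids = avoids-all-▸ ps (avoids ν) (proj₁ (grow x x≡ℓ))
      ; state  = t
      ; inv    = proj₂ (grow x x≡ℓ)
      }
      where
      x   = fromℕ< (s≤s ℓ≤1+n)
      x≡ℓ = toℕ-fromℕ< (s≤s ℓ≤1+n)

    offspring : List (Node (suc n))
    offspring = All.reduce sprout (sound (state ν) (inv ν))

  reduce-leaves : ∀ {n} (ν : Node n) m {cs} (ss : All (Sprout ps Inv (perm ν)) cs) →
    sum (map (leaves m ∘ state) (All.reduce (sprout ν) ss)) ≡ sum (map (leaves m ∘ proj₂) cs)
  reduce-leaves ν m []       = refl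
  reduce-leaves ν m (s ∷ ss) = cong (_ +_) (reduce-leaves ν m ss)

  reduce-covers : ∀ {n} (ν : Node n) {cs} (ss : All (Sprout ps Inv (perm ν)) cs) x → toℕ x ∈ map proj₁ cs →
    Any (λ μ → (x ▸ perm ν) Perm.≈ perm μ) (All.reduce (sprout ν) ss)
  reduce-covers ν (s ∷ ss) x (here x≡ℓ) = here λ i →
    cong (λ y → (y ▸ perm ν) ⟨$⟩ʳ i) (toℕ-injective (trans x≡ℓ (sym (toℕ-fromℕ< (s≤s (proj₁ s))))))
  reduce-covers ν (s ∷ ss) x (there x∈) = there (reduce-covers ν ss x x∈)

  infix 4 _≉_
  _≉_ : ∀ {n} → Node n → Node n → Set
  ν ≉ μ = ¬ perm ν Perm.≈ perm μ

  -- Siblings are told apart by their first letters.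
  reduce-≉ : ∀ {n} (ν : Node n) {c} (s : Sprout ps Inv (perm ν) c) {cs} (ss : All (Sprout ps Inv (perm ν)) cs) →
    All (λ k → ¬ proj₁ c ≡ k) (map proj₁ cs) → All (sprout ν s ≉_) (All.reduce (sprout ν) ss)
  reduce-≉ ν s []       []         = []
  reduce-≉ ν s (r ∷ ss) (ℓ≢ ∷ ℓ≢s) =
    (λ eq → ℓ≢ (begin
      _                               ≡⟨ toℕ-fromℕ< (s≤s (proj₁ s)) ⟨
      toℕ (fromℕ< (s≤s (proj₁ s)))   ≡⟨ cong toℕ (eq zero) ⟩
      toℕ (fromℕ< (s≤s (proj₁ r)))   ≡⟨ toℕ-fromℕ< (s≤s (proj₁ r)) ⟩
      _                               ∎))
    ∷ reduce-≉ ν s ss ℓ≢s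
    where open ≡-Reasoning

  reduce-distinct : ∀ {n} (ν : Node n) {cs} (ss : All (Sprout ps Inv (perm ν)) cs) → Unique (map proj₁ cs) →
    AllPairs _≉_ (All.reduce (sprout ν) ss)
  reduce-distinct ν []       []         = []
  reduce-distinct ν (s ∷ ss) (ℓ≢s ∷ !s) = reduce-≉ ν s ss ℓ≢s ∷ reduce-distinct ν ss !s

  -- Children of different parents are told apart by what is left when the first letter is deleted.
  reduce-separated : ∀ {n} {ν μ : Node n} {cs ds} (ss : All (Sprout ps Inv (perm ν)) cs) (ts : All (Sprout ps Inv (perm μ)) ds) →
    ν ≉ μ → All (λ ν′ → All (ν′ ≉_) (All.reduce (sprout μ) ts)) (All.reduce (sprout ν) ss)
  reduce-separated []       ts ν≉μ = []
  reduce-separated {ν = ν} {μ} (s ∷ ss) ts ν≉μ = row ts ∷ reduce-separated {ν = ν} {μ} ss ts ν≉μ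
    where
    row : ∀ {ds} (ts : All (Sprout ps Inv (perm μ)) ds) → All (sprout ν s ≉_) (All.reduce (sprout μ) ts)
    row []       = []
    row (t ∷ ts) = (λ eq → ν≉μ (▸-injectiveʳ {π = perm ν} {perm μ} eq)) ∷ row ts

  rootNode : Node 0
  rootNode = record
    { perm = Perm.id ; avoids = All.universal (avoids-singleton Perm.id) ps ; state = root ; inv = inv-root }

  nodes : ∀ m → List (Node m)
  nodes zero    = rootNode ∷ []
  nodes (suc m) = concatMap offspring (nodes m)

  -- The look-ahead `r` is generalized so that the induction can trade one generation of nodes for
  -- one more generation of look-ahead. At `r = 0` every node counts once, which gives the length.
  leaves-nodes : ∀ r m → sum (map (leaves r ∘ state) (nodes m)) ≡ leaves (m + r) root
  leaves-nodes r zero    = +-identityʳ _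
  leaves-nodes r (suc m) = begin
    sum (map (leaves r ∘ state) (concatMap offspring (nodes m)))
      ≡⟨ sum-map-concatMap (leaves r ∘ state) offspring (nodes m) ⟩
    sum (map (λ ν → sum (map (leaves r ∘ state) (offspring ν))) (nodes m))
      ≡⟨ cong sum (map-cong (λ ν → reduce-leaves ν r (sound (state ν) (inv ν))) (nodes m)) ⟩
    sum (map (leaves (suc r) ∘ state) (nodes m))
      ≡⟨ leaves-nodes (suc r) m ⟩
    leaves (m + suc r) root
      ≡⟨ cong (λ k → leaves k root) (+-suc m r) ⟩
    leaves (suc m + r) root ∎
    where open ≡-Reasoning

  length-nodes : ∀ m → length (nodes m) ≡ leaves m root
  length-nodes m = begin
    length (nodes m)                        ≡⟨ length≡sum-ones (nodes m) ⟩
    sum (map (leaves 0 ∘ state) (nodes m))  ≡⟨ leaves-nodes 0 m ⟩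
    leaves (m + 0) root             ≡⟨ cong (λ k → leaves k root) (+-identityʳ m) ⟩
    leaves m root                   ∎
    where
    open ≡-Reasoning
    length≡sum-ones : ∀ {n} (νs : List (Node n)) → length νs ≡ sum (map (leaves 0 ∘ state) νs)
    length≡sum-ones []       = refl
    length≡sum-ones (ν ∷ νs) = cong suc (length≡sum-ones νs)

  -- Delete the first letter: the rest avoids the patterns and is listed by induction, and
  -- `complete` then finds the deleted letter among the offspring of that node.
  nodes-cover : ∀ m (σ : Permutation′ (suc m)) → All (Avoids σ) ps →
    Any (λ ν → σ Perm.≈ perm ν) (nodes m)
  nodes-cover zero    σ av = here λ { zero → Fin1-prop _ _ }
    where
    Fin1-prop : (i j : Fin 1) → i ≡ j
    Fin1-prop zero zero = refl
  nodes-cover (suc m) σ av = Anyₚ.concatMap⁺ offspring (Any.map extend (nodes-cover m τ avτ))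
    where
    x = σ ⟨$⟩ʳ zero
    τ = remove zero σ

    σ≈x▸τ : σ Perm.≈ (x ▸ τ)
    σ≈x▸τ i = sym (Perm.insert-remove zero σ i)

    avx▸τ : All (Avoids (x ▸ τ)) ps
    avx▸τ = All.map (λ {p} → avoids-resp-≈ {π = σ} {x ▸ τ} σ≈x▸τ p) av

    avτ : All (Avoids τ) ps
    avτ = All.map (λ {p} a c → a (contains-▸ x τ p c)) avx▸τ

    extend : ∀ {ν} → τ Perm.≈ perm ν → Any (λ μ → σ Perm.≈ perm μ) (offspring ν)
    extend {ν} τ≈ν = Any.map (λ eq i → trans (σ≈x▸ν i) (eq i))
      (reduce-covers ν (sound (state ν) (inv ν)) x (complete (state ν) (inv ν) x fresh))
      where
      σ≈x▸ν : σ Perm.≈ (x ▸ perm ν)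
      σ≈x▸ν i = trans (σ≈x▸τ i) (▸-cong x {τ} {perm ν} τ≈ν i)

      fresh : Fresh ps x (perm ν)
      fresh = All.map (λ {p} a c → avoids-resp-≈ {π = σ} {x ▸ perm ν} σ≈x▸ν p a
                                     (contains-start (x ▸ perm ν) p c)) av

  nodes-distinct : ∀ m → AllPairs _≉_ (nodes m)
  nodes-distinct zero    = [] ∷ []
  nodes-distinct (suc m) = AllPairsₚ.concat⁺
    (Allₚ.map⁺ (All.universal
      (λ ν → reduce-distinct ν (sound (state ν) (inv ν)) (unique (state ν))) (nodes m)))
    (AllPairsₚ.map⁺ (AllPairs.map
      (λ {ν} {μ} → reduce-separated {ν = ν} {μ} (sound (state ν) (inv ν)) (sound (state μ) (inv μ)))
      (nodes-distinct m)))

  -- An avoider is sent to the index of the node that covers it. Distinctness of the nodes makes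
  -- this index independent of the proofs stored in the avoider and inverse to `lookup`.
  ∣S∣≡leaves : ∀ m → ∣ S (suc m) ps ∣≡ leaves m root
  ∣S∣≡leaves m = subst (∣ S (suc m) ps ∣≡_) (length-nodes m) record
    { to        = position
    ; from      = λ i → perm (lookup (nodes m) i) , avoids (lookup (nodes m) i)
    ; to-cong   = λ {σ} {τ} σ≈τ → same (position σ) (position τ) λ i →
        trans (sym (at-position σ i)) (trans (σ≈τ i) (at-position τ i))
    ; from-cong = λ { refl i → refl }
    ; inverse   =
        (λ {k} {σ} σ≈ → same (position σ) k λ i → trans (sym (at-position σ i)) (σ≈ i))
      , λ { {σ} refl i → sym (at-position σ i) }
    }
    where
    Avoider = Σ (Permutation′ (suc m)) λ σ → All (Avoids σ) ps

    position : Avoider → Fin (length (nodes m))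
    position (σ , av) = index (nodes-cover m σ av)

    at-position : ∀ σ → proj₁ σ Perm.≈ perm (lookup (nodes m) (position σ))
    at-position (σ , av) = Anyₚ.lookup-index (nodes-cover m σ av)

    same : ∀ i j → perm (lookup (nodes m) i) Perm.≈ perm (lookup (nodes m) j) → i ≡ j
    same = lookup-injective {R = λ ν μ → perm ν Perm.≈ perm μ} (λ eq i → sym (eq i)) (nodes-distinct m)

-- Generating rules of the four classes

letter-injective : ∀ {n} (π : Permutation′ n) {i j} → letter π i ≡ letter π j → i ≡ j
letter-injective π {i} {j} eq = begin
  i                        ≡⟨ Perm.inverseˡ π ⟨
  π ⟨$⟩ˡ (π ⟨$⟩ʳ i)        ≡⟨ cong (π ⟨$⟩ˡ_) (toℕ-injective eq) ⟩
  π ⟨$⟩ˡ (π ⟨$⟩ʳ j)        ≡⟨ Perm.inverseˡ π ⟩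
  j                        ∎
  where open ≡-Reasoning

letter-surjective : ∀ {n} (π : Permutation′ n) {v} → v < n → ∃[ i ] letter π i ≡ v
letter-surjective π v<n =
  π ⟨$⟩ˡ fromℕ< v<n , trans (cong toℕ (Perm.inverseʳ π)) (toℕ-fromℕ< v<n)

letter≤ : ∀ {n} (π : Permutation′ (suc n)) i → letter π i ≤ n
letter≤ π i = s≤s⁻¹ (toℕ<n (π ⟨$⟩ʳ i))

max≮ : ∀ {n} (π : Permutation′ (suc n)) {i} → letter π i ≡ n → ∀ k → ¬ letter π i < letter π k
max≮ π π≡n k p = <⇒≱ (subst (_< letter π k) π≡n p) (letter≤ π k)

-- The new letter enters through a number `ℓ` equal to it, so that the conditions below can speak
-- directly of 0, `n` or `suc n`.
module Prepend {n} (x : Fin (suc (suc n))) (π : Permutation′ (suc n)) {ℓ} (x≡ℓ : toℕ x ≡ ℓ) where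

  order : ∀ {i j} → letter (x ▸ π) (suc i) < letter (x ▸ π) (suc j) ⇔ letter π i < letter π j
  order = punchIn-mono-<⇔

  above : ∀ {i} → ℓ < letter (x ▸ π) (suc i) ⇔ ℓ ≤ letter π i
  above rewrite sym x≡ℓ = punchIn>x

  below : ∀ {i} → letter (x ▸ π) (suc i) < ℓ ⇔ letter π i < ℓ
  below rewrite sym x≡ℓ = punchIn<x

  keep : ∀ {i} → letter π i < ℓ → letter (x ▸ π) (suc i) ≡ letter π i
  keep rewrite sym x≡ℓ = punchIn-<

  shift : ∀ {i} → ℓ ≤ letter π i → letter (x ▸ π) (suc i) ≡ suc (letter π i)
  shift rewrite sym x≡ℓ = punchIn-≥


  start-1-23 : (¬ ContainsAtStart (x ▸ π) ⟨ 1 - 2 ∙ 3 ⟩) ⇔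
    (∀ j → ℓ ≤ letter π (inject₁ j) → letter π (inject₁ j) < letter π (suc j) → ⊥)
  start-1-23 rewrite sym x≡ℓ = mk⇔ (λ c j p q → c (j , from occurs-123 (p , q)))
                   (λ f (j , o) → uncurry (f j) (to occurs-123 o))

  start-1-32 : (¬ ContainsAtStart (x ▸ π) ⟨ 1 - 3 ∙ 2 ⟩) ⇔
    (∀ j → ℓ ≤ letter π (suc j) → letter π (suc j) < letter π (inject₁ j) → ⊥)
  start-1-32 rewrite sym x≡ℓ = mk⇔ (λ c j p q → c (j , from occurs-132 (p , q)))
                   (λ f (j , o) → uncurry (f j) (to occurs-132 o))

  start-2-13 : (¬ ContainsAtStart (x ▸ π) ⟨ 2 - 1 ∙ 3 ⟩) ⇔
    (∀ j → letter π (inject₁ j) < ℓ → ℓ ≤ letter π (suc j) → ⊥)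
  start-2-13 rewrite sym x≡ℓ = mk⇔ (λ c j p q → c (j , from occurs-213 (p , q)))
                   (λ f (j , o) → uncurry (f j) (to occurs-213 o))

  start-3-12 : (¬ ContainsAtStart (x ▸ π) ⟨ 3 - 1 ∙ 2 ⟩) ⇔
    (∀ j → letter π (inject₁ j) < letter π (suc j) → letter π (suc j) < ℓ → ⊥)
  start-3-12 rewrite sym x≡ℓ = mk⇔ (λ c j p q → c (j , from occurs-312 (p , q)))
                   (λ f (j , o) → uncurry (f j) (to occurs-312 o))

  start-12-3 : (¬ ContainsAtStart (x ▸ π) ⟨ 1 ∙ 2 - 3 ⟩) ⇔
    (∀ k → ℓ ≤ letter π zero → letter π zero < letter π (suc k) → ⊥)
  start-12-3 rewrite sym x≡ℓ = mk⇔ (λ c k p q → c (k , from occurs-123 (p , q)))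
                   (λ f (k , o) → uncurry (f k) (to occurs-123 o))

  start-21-3 : (¬ ContainsAtStart (x ▸ π) ⟨ 2 ∙ 1 - 3 ⟩) ⇔
    (∀ k → letter π zero < ℓ → ℓ ≤ letter π (suc k) → ⊥)
  start-21-3 rewrite sym x≡ℓ = mk⇔ (λ c k p q → c (k , from occurs-213 (p , q)))
                   (λ f (k , o) → uncurry (f k) (to occurs-213 o))

  start-23-1 : (¬ ContainsAtStart (x ▸ π) ⟨ 2 ∙ 3 - 1 ⟩) ⇔
    (∀ k → letter π (suc k) < ℓ → ℓ ≤ letter π zero → ⊥)
  start-23-1 rewrite sym x≡ℓ = mk⇔ (λ c k p q → c (k , from occurs-231 (p , q)))
                   (λ f (k , o) → uncurry (f k) (to occurs-231 o))

  start-31-2 : (¬ ContainsAtStart (x ▸ π) ⟨ 3 ∙ 1 - 2 ⟩) ⇔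
    (∀ k → letter π zero < letter π (suc k) → letter π (suc k) < ℓ → ⊥)
  start-31-2 rewrite sym x≡ℓ = mk⇔ (λ c k p q → c (k , from occurs-312 (p , q)))
                   (λ f (k , o) → uncurry (f k) (to occurs-312 o))

  start-32-1 : (¬ ContainsAtStart (x ▸ π) ⟨ 3 ∙ 2 - 1 ⟩) ⇔
    (∀ k → letter π (suc k) < letter π zero → letter π zero < ℓ → ⊥)
  start-32-1 rewrite sym x≡ℓ = mk⇔ (λ c k p q → c (k , from occurs-321 (p , q)))
                   (λ f (k , o) → uncurry (f k) (to occurs-321 o))

-- Children with letters i = lo, …, lo + k - 1; the second argument of g counts
-- those of these letters that are larger than i.

branch : ∀ {A : Set} → (ℕ → ℕ → A) → ℕ → ℕ → List (ℕ × A)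
branch g lo zero    = []
branch g lo (suc k) = (lo , g lo k) ∷ branch g (suc lo) k

module _ {A : Set} (g : ℕ → ℕ → A) where

  -- The equation `i + suc j ≡ lo + k` records that exactly `j` letters of the range exceed `i`.
  branch⁺ : ∀ {p} {P : ℕ × A → Set p} lo k →
    (∀ i j → lo ≤ i → i + suc j ≡ lo + k → P (i , g i j)) → All P (branch g lo k)
  branch⁺ lo zero    h = []
  branch⁺ lo (suc k) h = h lo k ≤-refl refl ∷ branch⁺ (suc lo) k λ i j lo<i eq →
    h i j (<⇒≤ lo<i) (trans eq (sym (+-suc lo k)))

  ∈-branch : ∀ {x} lo k → lo ≤ x → x < lo + k → x ∈ map proj₁ (branch g lo k)
  ∈-branch {x} lo zero    lo≤x x<lo = contradiction (subst (x <_) (+-identityʳ lo) x<lo) (≤⇒≯ lo≤x)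
  ∈-branch {x} lo (suc k) lo≤x x<hi with m≤n⇒m<n∨m≡n lo≤x
  ... | inj₁ lo<x = there (∈-branch (suc lo) k lo<x (subst (x <_) (+-suc lo k) x<hi))
  ... | inj₂ refl = here refl

  branch-unique : ∀ lo k → Unique (map proj₁ (branch g lo k))
  branch-unique lo zero    = []
  branch-unique lo (suc k) =
    Allₚ.map⁺ (branch⁺ (suc lo) k λ i j lo<i _ → <⇒≢ lo<i) ∷ branch-unique (suc lo) k

m+1+n≡1+k⇒m≤k : ∀ {m n k} → m + suc n ≡ suc k → m ≤ k
m+1+n≡1+k⇒m≤k {m} {n} eq = m+n≤o⇒m≤o m (≤-reflexive (suc-injective (trans (sym (+-suc m n)) eq)))

-- First class: quadratic growth

module Class₁ where

  patterns : List Pattern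
  patterns = ⟨ 1 ∙ 2 - 3 ⟩ ∷ ⟨ 1 - 2 ∙ 3 ⟩ ∷ ⟨ 3 ∙ 1 - 2 ⟩ ∷ ⟨ 3 - 1 ∙ 2 ⟩ ∷ []

  -- dec N: the decreasing word of length N.  asc v: a word containing an ascent
  -- and beginning with v, which only v + 1 may precede.
  data State : Set where
    dec asc : ℕ → State

  children : State → List (ℕ × State)
  children (dec N) = (N , dec (suc N)) ∷ branch (λ i _ → asc i) 0 N
  children (asc v) = (suc v , asc (suc v)) ∷ []

  -- In `asc v`, the later occurrence of `v + 1` rules out every new letter but `v + 1`. That letter
  -- stays admissible because each ascent goes from at most `v` to above `v`, so none lies wholly on
  -- one side of it.
  Inv : State → ∀ {n} → Permutation′ (suc n) → Set
  Inv (dec N) {n} π = suc n ≡ N × letter π zero ≡ n ×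
    (∀ j → ¬ letter π (inject₁ j) < letter π (suc j))
  Inv (asc v) {n} π = letter π zero ≡ v × (∃[ k ] letter π (suc k) ≡ suc v) ×
    (∀ j → letter π (inject₁ j) < letter π (suc j) → letter π (inject₁ j) ≤ v × v < letter π (suc j))

  module Dec {n} (π : Permutation′ (suc n)) (top : letter π zero ≡ n)
             (desc : ∀ j → ¬ letter π (inject₁ j) < letter π (suc j)) where

    π0≮ : ∀ k → ¬ letter π zero < letter π k
    π0≮ = max≮ π top

    fresh : ∀ x → Fresh patterns x π
    fresh x = from start-12-3 (λ k _ → π0≮ (suc k)) ∷ from start-1-23 (λ j _ → desc j)
            ∷ from start-31-2 (λ k p _ → π0≮ (suc k) p) ∷ from start-3-12 (λ j p _ → desc j p) ∷ []
      where open Prepend x π refl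

    inv-dec : ∀ x → toℕ x ≡ suc n → Inv (dec (suc (suc n))) (x ▸ π)
    inv-dec x x≡ = refl , x≡ , λ where
        zero    p → <⇒≱ (to above (subst (_< letter (x ▸ π) (suc zero)) x≡ p)) (letter≤ π zero)
        (suc j) p → desc j (to order p)
      where open Prepend x π x≡

    inv-asc : ∀ x {i} → i ≤ n → toℕ x ≡ i → Inv (asc i) (x ▸ π)
    -- The old letter with the value of `x` moves up to `x + 1`, which is the later letter that the
    -- label `asc` asks for.
    inv-asc x i≤n refl with k , πk≡x ← letter-surjective π (s≤s i≤n) =
      refl , (k , trans (shift (≤-reflexive (sym πk≡x))) (cong suc πk≡x)) , λ where
        zero    p → ≤-refl , p
        (suc j) p → contradiction (to order p) (desc j)
      where open Prepend x π refl

  module Asc {n} (π : Permutation′ (suc n)) {v} (π0≡v : letter π zero ≡ v)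
             {k} (πk≡1+v : letter π (suc k) ≡ suc v)
             (asc-v : ∀ j → letter π (inject₁ j) < letter π (suc j) →
                      letter π (inject₁ j) ≤ v × v < letter π (suc j)) where

    1+v≤n : suc v ≤ suc n
    1+v≤n = subst (λ u → suc u ≤ suc n) π0≡v (toℕ<n (π ⟨$⟩ʳ zero))

    fresh : ∀ x → toℕ x ≡ suc v → Fresh patterns x π
    fresh x x≡ =
        from start-12-3 (λ _ p _ → <⇒≱ p (≤-reflexive π0≡v))
      ∷ from start-1-23 (λ j p q → <⇒≱ p (proj₁ (asc-v j q)))
      ∷ from start-31-2 (λ _ p q → <⇒≱ (subst (_< _) π0≡v p) (s≤s⁻¹ q))
      ∷ from start-3-12 (λ j p q → <⇒≱ (proj₂ (asc-v j p)) (s≤s⁻¹ q)) ∷ []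
      where open Prepend x π x≡

    inv : ∀ x → toℕ x ≡ suc v → Inv (asc (suc v)) (x ▸ π)
    inv x x≡ = x≡ , (suc k , trans (shift (≤-reflexive (sym πk≡1+v))) (cong suc πk≡1+v)) , λ where
        zero    p → contradiction (to above (subst (_< letter (x ▸ π) (suc zero)) x≡ p))
                                  (<⇒≱ (s≤s (≤-reflexive π0≡v)))
        (suc j) p → let a≤v , v<b = asc-v j (to order p) in
          <⇒≤ (from below (s≤s a≤v)) , from above v<b
      where open Prepend x π x≡

    -- Together with `v` and the later `v + 1`, a letter above `v + 1` would form 31-2 and a letter
    -- at most `v` would form 12-3.
    only : ∀ x → Fresh patterns x π → toℕ x ≡ suc v
    only x (¬12-3 ∷ _ ∷ ¬31-2 ∷ _ ∷ []) = ≤-antisym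
      (≮⇒≥ λ p → to start-31-2 ¬31-2 k π0<πk (subst (_< toℕ x) (sym πk≡1+v) p))
      (≰⇒> λ p → to start-12-3 ¬12-3 k (subst (toℕ x ≤_) (sym π0≡v) p) π0<πk)
      where
      open Prepend x π refl
      π0<πk : letter π zero < letter π (suc k)
      π0<πk = ≤-reflexive (trans (cong suc π0≡v) (sym πk≡1+v))

  sound : ∀ s {n} {π : Permutation′ (suc n)} → Inv s π →
    All (Sprout patterns Inv π) (children s)
  sound (dec _) {n} {π} (refl , top , desc) =
    (≤-refl , λ x x≡ → fresh x , inv-dec x x≡) ∷
    branch⁺ _ 0 (suc n) λ i j _ i+1+j≡1+n → let i≤n = m+1+n≡1+k⇒m≤k i+1+j≡1+n in
      m≤n⇒m≤1+n i≤n , λ x x≡ → fresh x , inv-asc x i≤n x≡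
    where open Dec π top desc
  sound (asc v) {n} {π} (π0≡v , (k , πk≡1+v) , asc-v) =
    (1+v≤n , λ x x≡ → fresh x x≡ , inv x x≡) ∷ []
    where open Asc π π0≡v {k} πk≡1+v asc-v

  complete : ∀ s {n} {π : Permutation′ (suc n)} → Inv s π → ∀ x → Fresh patterns x π →
    toℕ x ∈ map proj₁ (children s)
  complete (dec _) {n} (refl , _) x _ with m≤n⇒m<n∨m≡n (s≤s⁻¹ (toℕ<n x))
  ... | inj₁ x<1+n = there (∈-branch _ 0 (suc n) z≤n x<1+n)
  ... | inj₂ x≡1+n = here x≡1+n
  complete (asc v) {π = π} (π0≡v , (k , πk≡1+v) , asc-v) x fr =
    here (Asc.only π π0≡v {k} πk≡1+v asc-v x fr)

  unique : ∀ s → Unique (map proj₁ (children s))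
  unique (dec N) = Allₚ.map⁺ (branch⁺ _ 0 N λ i j _ eq N≡i →
      m≢1+m+n i (trans (sym N≡i) (trans (sym eq) (+-suc i j)))) ∷ branch-unique _ 0 N
  unique (asc v) = [] ∷ []

  open GeneratingTree patterns children Inv sound complete unique
    (dec 1) (refl , refl , λ ())

  leaves-asc : ∀ m v → leaves m (asc v) ≡ 1
  leaves-asc zero    v = refl
  leaves-asc (suc m) v = trans (+-identityʳ _) (leaves-asc m (suc v))

  leaves-branch : ∀ m lo k → sum (map (leaves m ∘ proj₂) (branch (λ i _ → asc i) lo k)) ≡ k
  leaves-branch m lo zero    = refl
  leaves-branch m lo (suc k) = cong₂ _+_ (leaves-asc m lo) (leaves-branch m (suc lo) k)

  -- Each of the `N` children with an ascent has one descendant per generation, so a step adds `N`,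
  -- which is also the difference of `suc N C 2` and `N C 2`. The term `N C 2` stands on the left to
  -- avoid a subtraction.
  leaves-dec : ∀ m N → leaves m (dec N) + N C 2 ≡ 1 + (m + N) C 2
  leaves-dec zero    N = refl
  leaves-dec (suc m) N = begin
    leaves m (dec (suc N)) + sum (map (leaves m ∘ proj₂) (branch _ 0 N)) + N C 2
      ≡⟨ cong (λ s → leaves m (dec (suc N)) + s + N C 2) (leaves-branch m 0 N) ⟩
    leaves m (dec (suc N)) + N + N C 2    ≡⟨ +-assoc (leaves m (dec (suc N))) N _ ⟩
    leaves m (dec (suc N)) + (N + N C 2)
      ≡⟨ cong (λ c → leaves m (dec (suc N)) + (c + N C 2)) (nC1≡n N) ⟨
    leaves m (dec (suc N)) + (N C 1 + N C 2)
      ≡⟨ cong (leaves m (dec (suc N)) +_) (nCk+nC[k+1]≡[n+1]C[k+1] N 1) ⟩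
    leaves m (dec (suc N)) + suc N C 2    ≡⟨ leaves-dec m (suc N) ⟩
    1 + (m + suc N) C 2                   ≡⟨ cong (λ k → 1 + k C 2) (+-suc m N) ⟩
    1 + (suc m + N) C 2                   ∎
    where open ≡-Reasoning

  count : ∀ m → ∣ S (suc m) patterns ∣≡ 1 + suc m C 2
  -- The root is `dec 1`, for which the correction `1 C 2` vanishes.
  count m = subst (∣ S (suc m) patterns ∣≡_)
    (trans (sym (+-identityʳ _)) (trans (leaves-dec m 1) (cong (λ k → 1 + k C 2) (+-comm m 1))))
    (∣S∣≡leaves m)

-- Second class: central binomial coefficients

module Class₂ where

  patterns : List Pattern
  patterns = ⟨ 1 - 2 ∙ 3 ⟩ ∷ ⟨ 2 ∙ 1 - 3 ⟩ ∷ ⟨ 1 - 3 ∙ 2 ⟩ ∷ ⟨ 1 ∙ 2 - 3 ⟩ ∷ []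

  -- top lo k: begins with its maximum, and exactly the letters lo, …, lo + k may be
  -- prepended.  low w k: begins with w followed by the maximum, with k further
  -- letters between these two values; only a new maximum may be prepended.
  data State : Set where
    top low : ℕ → ℕ → State

  children : State → List (ℕ × State)
  children (top lo k) = (lo + k , top (lo + k) 1) ∷ branch low lo k
  children (low w k)  = (2 + (w + k) , top (suc w) (2 + k)) ∷ []

  -- In `top`, the third clause says that no two adjacent letters are both at least `lo`, and the
  -- fourth that every smaller bound fails this test. The test only gets easier as the bound grows,
  -- so `lo` is a sharp threshold.
  Inv : State → ∀ {n} → Permutation′ (suc n) → Set
  Inv (top lo k) {n} π = suc n ≡ lo + k × letter π zero ≡ n ×
    (∀ j → lo ≤ letter π (inject₁ j) → ¬ lo ≤ letter π (suc j)) ×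
    (∀ v → v < lo → ∃[ j ] v ≤ letter π (inject₁ j) × v ≤ letter π (suc j))
  Inv (low w k) {n} π = n ≡ suc (w + k) × letter π zero ≡ w ×
    (∃[ j ] letter π (inject₁ j) ≡ w × letter π (suc j) ≡ n) ×
    (∀ j → w < letter π (inject₁ j) → ¬ w < letter π (suc j))

  module _ {n} (π : Permutation′ (suc n)) (x : Fin (suc (suc n))) where
    open Prepend x π refl

    -- Adjacent letters are distinct, so 1-23 and 1-32 together forbid exactly an adjacent pair
    -- lying entirely at or above `x`.
    fresh⁺ : (∀ j → toℕ x ≤ letter π (inject₁ j) → ¬ toℕ x ≤ letter π (suc j)) →
      (∀ k → letter π zero < toℕ x → ¬ toℕ x ≤ letter π (suc k)) →
      (∀ k → toℕ x ≤ letter π zero → ¬ letter π zero < letter π (suc k)) → Fresh patterns x π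
    fresh⁺ pairs ¬21-3 ¬12-3 =
        from start-1-23 (λ j p q → pairs j p (≤-trans p (<⇒≤ q)))
      ∷ from start-21-3 ¬21-3
      ∷ from start-1-32 (λ j p q → pairs j (≤-trans p (<⇒≤ q)) p)
      ∷ from start-12-3 ¬12-3 ∷ []

    fresh⇒pairs : Fresh patterns x π → ∀ j → toℕ x ≤ letter π (inject₁ j) → ¬ toℕ x ≤ letter π (suc j)
    fresh⇒pairs (¬1-23 ∷ _ ∷ ¬1-32 ∷ _) j p q with <-cmp (letter π (inject₁ j)) (letter π (suc j))
    ... | tri< a<b _ _ = to start-1-23 ¬1-23 j p a<b
    ... | tri> _ _ b<a = to start-1-32 ¬1-32 j q b<a
    ... | tri≈ _ a≡b _ =
      <⇒≢ (s≤s (≤-reflexive (toℕ-inject₁ j))) (cong toℕ (letter-injective π {inject₁ j} {suc j} a≡b))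

  module Top {n} (π : Permutation′ (suc n)) {lo} (π0≡n : letter π zero ≡ n)
             (pairs : ∀ j → lo ≤ letter π (inject₁ j) → ¬ lo ≤ letter π (suc j))
             (blocked : ∀ v → v < lo → ∃[ j ] v ≤ letter π (inject₁ j) × v ≤ letter π (suc j)) where

    π0≮ : ∀ k → ¬ letter π zero < letter π k
    π0≮ = max≮ π π0≡n

    fresh : ∀ x → lo ≤ toℕ x → Fresh patterns x π
    fresh x lo≤x = fresh⁺ π x (λ j p q → pairs j (≤-trans lo≤x p) (≤-trans lo≤x q))
      (λ k p q → π0≮ (suc k) (≤-trans p q)) (λ k _ → π0≮ (suc k))

    inv-top : ∀ x → toℕ x ≡ suc n → Inv (top (suc n) 1) (x ▸ π)
    inv-top x x≡ = +-comm 1 (suc n) , x≡ ,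
      (λ j _ p → <⇒≱ (from below (s≤s (letter≤ π j))) p) ,
      -- The new word begins with `n + 1`, `n`, and this pair blocks every letter up to `n`.
      λ v v≤n → zero , ≤-trans (<⇒≤ v≤n) (≤-reflexive (sym x≡)) ,
                ≤-trans (s≤s⁻¹ v≤n) (≤-reflexive (sym (trans (keep (s≤s (letter≤ π zero))) π0≡n)))
      where open Prepend x π x≡

    inv-low : ∀ x {i j} → lo ≤ i → suc n ≡ i + suc j → toℕ x ≡ i → Inv (low i j) (x ▸ π)
    inv-low x {i} {j} lo≤i size x≡ = trans size (+-suc i j) , x≡ ,
      (zero , x≡ , trans (shift (≤-trans i≤n (≤-reflexive (sym π0≡n)))) (cong suc π0≡n)) , λ where
        zero    p _ → <⇒≢ p (sym x≡)
        (suc j) p q → pairs j (≤-trans lo≤i (to above p)) (≤-trans lo≤i (to above q))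
      where
      open Prepend x π x≡
      i≤n = m+1+n≡1+k⇒m≤k (sym size)

    only : ∀ x → Fresh patterns x π → lo ≤ toℕ x
    only x fr = ≮⇒≥ λ x<lo → let j , p , q = blocked (toℕ x) x<lo in fresh⇒pairs π x fr j p q

  module Low {n} (π : Permutation′ (suc n)) {w} (w<n : w < n) (π0≡w : letter π zero ≡ w)
             {j₀} (a≡w : letter π (inject₁ j₀) ≡ w) (b≡n : letter π (suc j₀) ≡ n)
             (pairs : ∀ j → w < letter π (inject₁ j) → ¬ w < letter π (suc j)) where

    fresh : ∀ x → toℕ x ≡ suc n → Fresh patterns x π
    fresh x x≡ = fresh⁺ π x (λ j p _ → big (inject₁ j) p) (λ k _ → big (suc k)) (λ _ p _ → big zero p)
      where
      big : ∀ k → ¬ toℕ x ≤ letter π k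
      big k p = <⇒≱ (subst (_≤ letter π k) x≡ p) (letter≤ π k)

    inv : ∀ x {k} → n ≡ suc (w + k) → toℕ x ≡ suc n → Inv (top (suc w) (2 + k)) (x ▸ π)
    inv x {k} size x≡ = cong suc (trans (cong suc size) (sym (trans (+-suc w (suc k)) (cong suc (+-suc w k))))) , x≡ ,
      (λ where
        zero    _ p → <⇒≱ p (≤-reflexive (trans (same zero) π0≡w))
        (suc j) p q → pairs j (subst (w <_) (same (inject₁ j)) p) (subst (w <_) (same (suc j)) q)) ,
      -- The adjacent pair `w`, `n` inherited from `π` blocks every letter up to `w`, so the
      -- threshold is `suc w`.
      λ v v≤w → suc j₀ , ≤-trans (s≤s⁻¹ v≤w) (≤-reflexive (sym (trans (same (inject₁ j₀)) a≡w))) ,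
                ≤-trans (≤-trans (s≤s⁻¹ v≤w) (<⇒≤ w<n)) (≤-reflexive (sym (trans (same (suc j₀)) b≡n)))
      where
      open Prepend x π x≡
      same : ∀ i → letter (x ▸ π) (suc i) ≡ letter π i
      same i = keep (s≤s (letter≤ π i))

    -- If `x ≤ w`, the adjacent pair `w`, `n` lies at or above `x`. If `w < x ≤ n`, then `x`, `w`
    -- and the later `n` form 21-3.
    only : ∀ x → Fresh patterns x π → toℕ x ≡ suc n
    only x fr@(_ ∷ ¬21-3 ∷ _) = ≤-antisym (s≤s⁻¹ (toℕ<n x))
      (≰⇒> λ x≤n → to start-21-3 ¬21-3 j₀ (subst (_< toℕ x) (sym π0≡w) w<x) (subst (toℕ x ≤_) (sym b≡n) x≤n))
      where
      open Prepend x π refl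
      w<x : w < toℕ x
      w<x = ≰⇒> λ x≤w → fresh⇒pairs π x fr j₀ (subst (toℕ x ≤_) (sym a≡w) x≤w)
                          (subst (toℕ x ≤_) (sym b≡n) (≤-trans x≤w (<⇒≤ w<n)))

  w<1+w+k : ∀ w k → w < suc (w + k)
  w<1+w+k w k = s≤s (m≤m+n w k)

  sound : ∀ s {n} {π : Permutation′ (suc n)} → Inv s π →
    All (Sprout patterns Inv π) (children s)
  sound (top lo k) {n} {π} (size , π0≡n , pairs , blocked) =
    subst (λ ℓ → Sprout patterns Inv π (ℓ , top ℓ 1)) size
      (≤-refl , λ x x≡ → fresh x (≤-trans lo≤1+n (≤-reflexive (sym x≡))) , inv-top x x≡) ∷
    branch⁺ low lo k λ i j lo≤i i+1+j≡lo+k →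
      let i+1+j≡1+n = trans i+1+j≡lo+k (sym size) in
      m≤n⇒m≤1+n (m+1+n≡1+k⇒m≤k i+1+j≡1+n) , λ x x≡ →
        fresh x (≤-trans lo≤i (≤-reflexive (sym x≡))) , inv-low x lo≤i (sym i+1+j≡1+n) x≡
    where
    open Top π π0≡n pairs blocked
    lo≤1+n : lo ≤ suc n
    lo≤1+n = ≤-trans (m≤m+n lo k) (≤-reflexive (sym size))
  sound (low w k) {π = π} (refl , π0≡w , (j₀ , a≡w , b≡n) , pairs) =
    (≤-refl , λ x x≡ → fresh x x≡ , inv x refl x≡) ∷ []
    where open Low π (w<1+w+k w k) π0≡w {j₀} a≡w b≡n pairs

  complete : ∀ s {n} {π : Permutation′ (suc n)} → Inv s π → ∀ x → Fresh patterns x π →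
    toℕ x ∈ map proj₁ (children s)
  complete (top lo k) {π = π} (size , π0≡n , pairs , blocked) x fr with m≤n⇒m<n∨m≡n (s≤s⁻¹ (toℕ<n x))
  ... | inj₁ x<1+n = there (∈-branch low lo k (Top.only π π0≡n pairs blocked x fr)
                                              (≤-trans x<1+n (≤-reflexive size)))
  ... | inj₂ x≡1+n = here (trans x≡1+n size)
  complete (low w k) {π = π} (refl , π0≡w , (j₀ , a≡w , b≡n) , pairs) x fr =
    here (Low.only π (w<1+w+k w k) π0≡w {j₀} a≡w b≡n pairs x fr)

  unique : ∀ s → Unique (map proj₁ (children s))
  unique (top lo k) = Allₚ.map⁺ (branch⁺ low lo k λ i j _ i+1+j≡lo+k lo+k≡i →
    m≢1+m+n i (trans (sym lo+k≡i) (trans (sym i+1+j≡lo+k) (+-suc i j)))) ∷ branch-unique low lo k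
  unique (low w k)  = [] ∷ []

  open GeneratingTree patterns children Inv sound complete unique (top 0 1)
    (refl , refl , (λ ()) , λ _ ())

  -- Symmetry of the binomial row: the complement of `⌈ m /2⌉` in `suc m` is `suc ⌊ m /2⌋`, which is
  -- `⌈ suc m /2⌉` by computation.
  middle : ∀ m → suc m C ⌈ m /2⌉ ≡ suc m C ⌈ suc m /2⌉
  middle m = begin
    suc m C ⌈ m /2⌉                             ≡⟨ nCk≡nC[n∸k] (m≤n⇒m≤1+n (⌈n/2⌉≤n m)) ⟩
    suc m C (suc m ∸ ⌈ m /2⌉)
      ≡⟨ cong (λ r → suc m C (suc r ∸ ⌈ m /2⌉)) (⌊n/2⌋+⌈n/2⌉≡n m) ⟨
    suc m C (suc ⌊ m /2⌋ + ⌈ m /2⌉ ∸ ⌈ m /2⌉)  ≡⟨ cong (suc m C_) (m+n∸n≡m (suc ⌊ m /2⌋) ⌈ m /2⌉) ⟩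
    suc m C ⌈ suc m /2⌉                         ∎
    where open ≡-Reasoning

  -- Once the child `low lo k` is split off, the remaining children are those of `top (suc lo) k`,
  -- and Pascal's rule adds the two counts. At `k = 0` only the new maximum is left and `middle`
  -- applies.
  leaves-top : ∀ m lo k → leaves m (top lo k) ≡ (k + m) C ⌈ m /2⌉
  leaves-top zero          lo k       = refl
  leaves-top (suc m)       lo zero    = begin
    leaves m (top (lo + 0) 1) + 0   ≡⟨ +-identityʳ _ ⟩
    leaves m (top (lo + 0) 1)       ≡⟨ leaves-top m (lo + 0) 1 ⟩
    suc m C ⌈ m /2⌉                 ≡⟨ middle m ⟩
    suc m C ⌈ suc m /2⌉             ∎
    where open ≡-Reasoning
  leaves-top (suc m)       lo (suc k) = begin
    leaves m (top (lo + suc k) 1) + (leaves m (low lo k) + B)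
      ≡⟨ cong (λ i → leaves m (top i 1) + (leaves m (low lo k) + B)) (+-suc lo k) ⟩
    A + (leaves m (low lo k) + B)    ≡⟨ x∙yz≈y∙xz A _ B ⟩
    leaves m (low lo k) + (A + B)    ≡⟨ cong₂ _+_ (leaves-low m lo k) (leaves-top (suc m) (suc lo) k) ⟩
    (k + suc m) C ⌊ m /2⌋ + (k + suc m) C suc ⌊ m /2⌋
      ≡⟨ nCk+nC[k+1]≡[n+1]C[k+1] (k + suc m) ⌊ m /2⌋ ⟩
    (suc k + suc m) C suc ⌊ m /2⌋    ∎
    where
    open ≡-Reasoning
    A = leaves m (top (suc lo + k) 1)
    B = sum (map (leaves m ∘ proj₂) (branch low (suc lo) k))
    -- The only child of a `low` word is a `top` word with `2 + k`, so one generation is spent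
    -- without branching.
    leaves-low : ∀ m w k → leaves m (low w k) ≡ (k + suc m) C ⌊ m /2⌋
    leaves-low zero    w k = refl
    leaves-low (suc m) w k = begin
      leaves m (top (suc w) (2 + k)) + 0   ≡⟨ +-identityʳ _ ⟩
      leaves m (top (suc w) (2 + k))       ≡⟨ leaves-top m (suc w) (2 + k) ⟩
      (2 + k + m) C ⌈ m /2⌉                ≡⟨ cong (_C ⌈ m /2⌉) (sym (trans (+-suc k (suc m)) (cong suc (+-suc k m)))) ⟩
      (k + suc (suc m)) C ⌊ suc m /2⌋      ∎

  count : ∀ m → ∣ S (suc m) patterns ∣≡ suc m C ⌈ suc m /2⌉
  count m = subst (∣ S (suc m) patterns ∣≡_) (trans (leaves-top m 0 1) (middle m)) (∣S∣≡leaves m)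

-- Partial row sums of Pascal's triangle

rowSum : ℕ → ℕ → ℕ
rowSum n zero    = 0
rowSum n (suc m) = rowSum n m + n C m

rowSum-pascal : ∀ n m → rowSum (suc n) (suc m) ≡ rowSum n (suc m) + rowSum n m
rowSum-pascal n zero    = refl
rowSum-pascal n (suc m) = begin
  rowSum (suc n) (suc m) + suc n C suc m
    ≡⟨ cong₂ _+_ (rowSum-pascal n m) (sym (nCk+nC[k+1]≡[n+1]C[k+1] n m)) ⟩
  (rowSum n (suc m) + rowSum n m) + (n C m + n C suc m)
    ≡⟨ cong ((rowSum n (suc m) + rowSum n m) +_) (+-comm (n C m) _) ⟩
  (rowSum n (suc m) + rowSum n m) + (n C suc m + n C m)
    ≡⟨ interchange (rowSum n (suc m)) (rowSum n m) (n C suc m) (n C m) ⟩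
  rowSum n (suc (suc m)) + rowSum n (suc m) ∎
  where
  open ≡-Reasoning

-- Pascal's rule counts each row twice in the next one; the surplus entry `n C suc n` is zero.
rowSum-full : ∀ n → rowSum n (suc n) ≡ 2 ^ n
rowSum-full zero    = refl
rowSum-full (suc n) = begin
  rowSum (suc n) (suc (suc n))                    ≡⟨ rowSum-pascal n (suc n) ⟩
  rowSum n (suc n) + n C suc n + rowSum n (suc n)
    ≡⟨ cong (λ c → rowSum n (suc n) + c + rowSum n (suc n)) (k>n⇒nCk≡0 (n<1+n n)) ⟩
  rowSum n (suc n) + 0 + rowSum n (suc n)
    ≡⟨ cong (_+ rowSum n (suc n)) (+-identityʳ (rowSum n (suc n))) ⟩
  rowSum n (suc n) + rowSum n (suc n)             ≡⟨ cong₂ _+_ (rowSum-full n) (trans (rowSum-full n) (sym (+-identityʳ _))) ⟩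
  2 ^ suc n                                       ∎
  where open ≡-Reasoning

-- Third class: powers of two

module Class₃ where

  patterns : List Pattern
  patterns = ⟨ 1 - 2 ∙ 3 ⟩ ∷ ⟨ 2 ∙ 3 - 1 ⟩ ∷ ⟨ 3 - 1 ∙ 2 ⟩ ∷ ⟨ 1 ∙ 2 - 3 ⟩ ∷ []

  -- dec m: the decreasing word of length m + 1.  asc lo k: a word with an ascent,
  -- necessarily from the minimum to the maximum, to which exactly the letters
  -- lo, …, lo + k - 1 may be prepended.
  data State : Set where
    dec : ℕ → State
    asc : ℕ → ℕ → State

  children : State → List (ℕ × State)
  children (dec m)    = (suc m , dec (suc m)) ∷ (0 , asc 1 (suc m)) ∷ []
  children (asc lo k) = branch (λ i j → asc (suc i) (suc j)) lo k

  -- The last clause of `asc` keeps `lo`, ..., `n` admissible: every ascent starts below such a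
  -- letter, so 1-23 does not arise, and ends at `n`, which is not below it, so neither does 3-12.
  Inv : State → ∀ {n} → Permutation′ (suc n) → Set
  Inv (dec m) {n} π = n ≡ m × letter π zero ≡ n ×
    (∀ j → ¬ letter π (inject₁ j) < letter π (suc j))
  Inv (asc lo k) {n} π = suc n ≡ lo + k × suc (letter π zero) ≡ lo × letter π zero < n ×
    (∃[ j ] letter π (inject₁ j) < letter π (suc j) × letter π (suc j) ≡ n) ×
    (∀ j → letter π (inject₁ j) < letter π (suc j) → letter π (inject₁ j) < lo × letter π (suc j) ≡ n)

  module Dec {n} (π : Permutation′ (suc n)) (top : letter π zero ≡ n)
             (desc : ∀ j → ¬ letter π (inject₁ j) < letter π (suc j)) where

    π0≮ : ∀ k → ¬ letter π zero < letter π k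
    π0≮ = max≮ π top

    fresh : ∀ x → (∀ k → letter π (suc k) < toℕ x → ¬ toℕ x ≤ letter π zero) → Fresh patterns x π
    fresh x ¬23-1 =
        from start-1-23 (λ j _ → desc j) ∷ from start-23-1 ¬23-1
      ∷ from start-3-12 (λ j p _ → desc j p) ∷ from start-12-3 (λ k _ → π0≮ (suc k)) ∷ []
      where open Prepend x π refl

    fresh-max : ∀ x → toℕ x ≡ suc n → Fresh patterns x π
    fresh-max x x≡ = fresh x λ _ _ p → <⇒≱ (subst (_≤ letter π zero) x≡ p) (letter≤ π zero)

    fresh-0 : ∀ x → toℕ x ≡ 0 → Fresh patterns x π
    fresh-0 x x≡ = fresh x λ k p _ → n≮0 (subst (letter π (suc k) <_) x≡ p)

    inv-dec : ∀ x → toℕ x ≡ suc n → Inv (dec (suc n)) (x ▸ π)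
    inv-dec x x≡ = refl , x≡ , λ where
        zero    p → <⇒≱ (to above (subst (_< letter (x ▸ π) (suc zero)) x≡ p)) (letter≤ π zero)
        (suc j) p → desc j (to order p)
      where open Prepend x π x≡

    inv-asc : ∀ x → toℕ x ≡ 0 → Inv (asc 1 (suc n)) (x ▸ π)
    inv-asc x x≡ = refl , cong suc x≡ , subst (_< suc n) (sym x≡) (s≤s z≤n) ,
      (zero , subst₂ _<_ (sym x≡) (sym second) (s≤s z≤n) , second) , λ where
        zero    _ → s≤s (≤-reflexive x≡) , second
        (suc j) p → contradiction (to order p) (desc j)
      where
      open Prepend x π x≡
      second : letter (x ▸ π) (suc zero) ≡ suc n
      second = trans (shift z≤n) (cong suc top)

    -- A letter with `0 < x ≤ n` followed by the first letter `n` and a later 0 would form 23-1.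
    only : ∀ x → Fresh patterns x π → toℕ x ≡ suc n ⊎ toℕ x ≡ 0
    only x (_ ∷ ¬23-1 ∷ _) with m≤n⇒m<n∨m≡n (s≤s⁻¹ (toℕ<n x)) | letter-surjective π (s≤s (z≤n {n}))
    ... | inj₂ x≡1+n | _ = inj₁ x≡1+n
    -- If 0 is itself the first letter, then `n = 0` and the bound `x ≤ n` suffices.
    ... | inj₁ x<1+n | zero , π0≡0 =
      inj₂ (n≤0⇒n≡0 (subst (toℕ x ≤_) (trans (sym top) π0≡0) (s≤s⁻¹ x<1+n)))
    ... | inj₁ x<1+n | suc k , πk≡0 = inj₂ (n≤0⇒n≡0 (subst (toℕ x ≤_) πk≡0
      (≮⇒≥ λ p → to start-23-1 ¬23-1 k p (subst (toℕ x ≤_) (sym top) (s≤s⁻¹ x<1+n)))))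
      where open Prepend x π refl

  module Asc {n} (π : Permutation′ (suc n)) {lo} (1+π0≡lo : suc (letter π zero) ≡ lo) (π0<n : letter π zero < n)
             {j₀} (a<b : letter π (inject₁ j₀) < letter π (suc j₀)) (b≡n : letter π (suc j₀) ≡ n)
             (asc-n : ∀ j → letter π (inject₁ j) < letter π (suc j) →
                      letter π (inject₁ j) < lo × letter π (suc j) ≡ n) where

    x≰π0 : ∀ {i} → lo ≤ i → ¬ i ≤ letter π zero
    x≰π0 lo≤i = <⇒≱ (≤-trans (≤-reflexive 1+π0≡lo) lo≤i)

    fresh : ∀ x {i} → lo ≤ i → i ≤ n → toℕ x ≡ i → Fresh patterns x π
    fresh x lo≤i i≤n x≡ =
        from start-1-23 (λ j p q → <⇒≱ (proj₁ (asc-n j q)) (≤-trans lo≤i p))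
      ∷ from start-23-1 (λ _ _ → x≰π0 lo≤i)
      ∷ from start-3-12 (λ j p q → <⇒≱ q (≤-trans i≤n (≤-reflexive (sym (proj₂ (asc-n j p))))))
      ∷ from start-12-3 (λ _ p _ → x≰π0 lo≤i p) ∷ []
      where open Prepend x π x≡

    inv : ∀ x {i j} → lo ≤ i → i ≤ n → suc n ≡ i + suc j → toℕ x ≡ i → Inv (asc (suc i) (suc j)) (x ▸ π)
    inv x lo≤i i≤n size x≡ = cong suc size , cong suc x≡ , subst (_< suc n) (sym x≡) (s≤s i≤n) ,
      (suc j₀ , from order a<b , top j₀ b≡n) , λ where
        zero    p → contradiction (to above (subst (_< letter (x ▸ π) (suc zero)) x≡ p)) (x≰π0 lo≤i)
        (suc j) p → let a<lo , b≡n = asc-n j (to order p) in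
          m<n⇒m<1+n (from below (≤-trans a<lo lo≤i)) , top j b≡n
      where
      open Prepend x π x≡
      top : ∀ j → letter π (suc j) ≡ n → letter (x ▸ π) (suc (suc j)) ≡ suc n
      top j b≡n = trans (shift (≤-trans i≤n (≤-reflexive (sym b≡n)))) (cong suc b≡n)

    -- A letter not above the first one forms 12-3 with it and the later `n`; a letter above `n`
    -- forms 3-12 with the ascent that ends at `n`.
    only : ∀ x → Fresh patterns x π → lo ≤ toℕ x × toℕ x ≤ n
    only x (_ ∷ _ ∷ ¬3-12 ∷ ¬12-3 ∷ []) =
        subst (_≤ toℕ x) 1+π0≡lo (≰⇒> λ p → to start-12-3 ¬12-3 j₀ p (subst (letter π zero <_) (sym b≡n) π0<n))
      , subst (toℕ x ≤_) b≡n (≮⇒≥ (to start-3-12 ¬3-12 j₀ a<b))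
      where open Prepend x π refl

  sound : ∀ s {n} {π : Permutation′ (suc n)} → Inv s π →
    All (Sprout patterns Inv π) (children s)
  sound (dec m) {π = π} (refl , top , desc) =
    (≤-refl , λ x x≡ → fresh-max x x≡ , inv-dec x x≡) ∷
    (z≤n , λ x x≡ → fresh-0 x x≡ , inv-asc x x≡) ∷ []
    where open Dec π top desc
  sound (asc lo k) {n} {π} (size , 1+π0≡lo , π0<n , (j₀ , a<b , b≡n) , asc-n) =
    branch⁺ _ lo k λ i j lo≤i i+1+j≡lo+k →
      let i+1+j≡1+n = trans i+1+j≡lo+k (sym size)
          i≤n       = m+1+n≡1+k⇒m≤k i+1+j≡1+n
      in m≤n⇒m≤1+n i≤n , λ x x≡ → fresh x lo≤i i≤n x≡ , inv x lo≤i i≤n (sym i+1+j≡1+n) x≡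
    where open Asc π 1+π0≡lo π0<n {j₀} a<b b≡n asc-n

  complete : ∀ s {n} {π : Permutation′ (suc n)} → Inv s π → ∀ x → Fresh patterns x π →
    toℕ x ∈ map proj₁ (children s)
  complete (dec m) {π = π} (refl , top , desc) x fr with Dec.only π top desc x fr
  ... | inj₁ x≡1+n = here x≡1+n
  ... | inj₂ x≡0   = there (here x≡0)
  complete (asc lo k) {π = π} (size , 1+π0≡lo , π0<n , (j₀ , a<b , b≡n) , asc-n) x fr =
    let lo≤x , x≤n = Asc.only π 1+π0≡lo π0<n {j₀} a<b b≡n asc-n x fr in
    ∈-branch _ lo k lo≤x (≤-trans (s≤s x≤n) (≤-reflexive size))

  unique : ∀ s → Unique (map proj₁ (children s))
  unique (dec m)    = ((λ ()) ∷ []) ∷ [] ∷ []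
  unique (asc lo k) = branch-unique _ lo k

  open GeneratingTree patterns children Inv sound complete unique (dec 0)
    (refl , refl , λ ())

  leaves-asc : ∀ m lo k → leaves m (asc lo (suc k)) ≡ (k + m) C m
  -- The children in the branch have `suc k`, ..., 1 admissible letters, so the counts run down a
  -- column of Pascal's triangle and this is the hockey-stick identity.
  leaves-branch : ∀ m lo k →
    sum (map (leaves m ∘ proj₂) (branch (λ i j → asc (suc i) (suc j)) lo (suc k))) ≡ (suc k + m) C suc m

  leaves-asc zero    lo k = refl
  leaves-asc (suc m) lo k = trans (leaves-branch m lo k) (cong (_C suc m) (sym (+-suc k m)))

  leaves-branch m lo zero    = begin
    leaves m (asc (suc lo) 1) + 0   ≡⟨ +-identityʳ _ ⟩
    leaves m (asc (suc lo) 1)       ≡⟨ leaves-asc m (suc lo) 0 ⟩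
    m C m                           ≡⟨ nCn≡1 m ⟩
    1                               ≡⟨ nCn≡1 (suc m) ⟨
    suc m C suc m                   ∎
    where open ≡-Reasoning
  leaves-branch m lo (suc k) = begin
    leaves m (asc (suc lo) (suc (suc k))) + sum (map _ (branch _ (suc lo) (suc k)))
      ≡⟨ cong₂ _+_ (leaves-asc m (suc lo) (suc k)) (leaves-branch m (suc lo) k) ⟩
    (suc k + m) C m + (suc k + m) C suc m    ≡⟨ nCk+nC[k+1]≡[n+1]C[k+1] (suc k + m) m ⟩
    (suc (suc k) + m) C suc m                ∎
    where open ≡-Reasoning

  -- Each step along the decreasing words contributes one binomial coefficient from the child with
  -- an ascent. As `N` grows while `m` falls, `N + m` is constant and all contributions lie in one
  -- row. Counting `suc m` generations keeps that row index free of subtraction.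
  leaves-dec : ∀ m N → leaves (suc m) (dec N) ≡ suc (rowSum (N + m) (suc m))
  leaves-dec zero    N = refl
  leaves-dec (suc m) N = begin
    leaves (suc m) (dec (suc N)) + (leaves (suc m) (asc 1 (suc N)) + 0)
      ≡⟨ cong₂ _+_ (leaves-dec m (suc N)) (trans (+-identityʳ _) (leaves-asc (suc m) 1 N)) ⟩
    suc (rowSum (suc N + m) (suc m)) + (N + suc m) C suc m
      ≡⟨ cong (λ k → suc (rowSum k (suc m)) + (N + suc m) C suc m) (sym (+-suc N m)) ⟩
    suc (rowSum (N + suc m) (suc (suc m))) ∎
    where open ≡-Reasoning

  count : ∀ m → ∣ S (2 + m) patterns ∣≡ 2 ^ m + 1
  -- At `N = 0` the partial sum is the whole row `m`.
  count m = subst (∣ S (2 + m) patterns ∣≡_)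
    (trans (leaves-dec m 0) (trans (cong suc (rowSum-full m)) (+-comm 1 (2 ^ m))))
    (∣S∣≡leaves (suc m))

-- Fourth class: a constant count

module Class₄ where

  patterns : List Pattern
  patterns = ⟨ 1 ∙ 2 - 3 ⟩ ∷ ⟨ 2 - 1 ∙ 3 ⟩ ∷ ⟨ 3 ∙ 2 - 1 ⟩ ∷ ⟨ 2 ∙ 1 - 3 ⟩ ∷ []

  -- Lengths are m + 2: low m begins with the minimum followed by the maximum, high m
  -- with the maximum; nothing may be prepended to a stuck word.
  data State : Set where
    single      : State
    low high : ℕ → State
    stuck       : State

  children : State → List (ℕ × State)
  children single   = (0 , low 0) ∷ (1 , high 0) ∷ []
  children (low m)  = (suc (suc m) , high (suc m)) ∷ []
  children (high m) = (0 , low (suc m)) ∷ (suc m , stuck) ∷ []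
  children stuck    = []

  -- The last clause of `high` provides, for each `v` strictly between 0 and `n`, an adjacent pair
  -- with which `v` would form 2-13. In `low`, the adjacent pair 0, `n` straddles all these values
  -- at once.
  Inv : State → ∀ {n} → Permutation′ (suc n) → Set
  Inv single   {n} π = n ≡ 0
  Inv (low m)  {n} π = n ≡ suc m × letter π zero ≡ 0 ×
    (∃[ j ] letter π (inject₁ j) ≡ 0 × letter π (suc j) ≡ n)
  Inv (high m) {n} π = n ≡ suc m × letter π zero ≡ n × (∃[ k ] letter π (suc k) ≡ 0) ×
    (∀ v → 0 < v → v < n → ∃[ j ] letter π (inject₁ j) < v × v ≤ letter π (suc j))
  Inv stuck        π = (∃[ k ] letter π zero < letter π (suc k)) × (∃[ k ] letter π (suc k) < letter π zero)

  module Single (π : Permutation′ 1) where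

    fresh : ∀ x → Fresh patterns x π
    fresh x = from start-12-3 (λ ()) ∷ from start-2-13 (λ ()) ∷ from start-32-1 (λ ()) ∷ from start-21-3 (λ ()) ∷ []
      where open Prepend x π refl

    π0≡0 : letter π zero ≡ 0
    π0≡0 = n≤0⇒n≡0 (letter≤ π zero)

    inv-low : ∀ x → toℕ x ≡ 0 → Inv (low 0) (x ▸ π)
    inv-low x x≡ = refl , x≡ , zero , x≡ , trans (shift z≤n) (cong suc π0≡0)
      where open Prepend x π x≡

    inv-high : ∀ x → toℕ x ≡ 1 → Inv (high 0) (x ▸ π)
    inv-high x x≡ = refl , x≡ , (zero , trans (keep (s≤s (≤-reflexive π0≡0))) π0≡0) ,
      λ v 0<v v<1 → contradiction v<1 (≤⇒≯ 0<v)
      where open Prepend x π x≡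

  module Low {n} (π : Permutation′ (suc n)) (0<n : 0 < n) (π0≡0 : letter π zero ≡ 0)
             {j} (a≡0 : letter π (inject₁ j) ≡ 0) (b≡n : letter π (suc j) ≡ n) where

    fresh : ∀ x → toℕ x ≡ suc n → Fresh patterns x π
    fresh x x≡ =
        from start-12-3 (λ _ p _ → <⇒≱ p (letter≤ π zero))
      ∷ from start-2-13 (λ j _ p → <⇒≱ p (letter≤ π (suc j)))
      ∷ from start-32-1 (λ k p _ → n≮0 (subst (letter π (suc k) <_) π0≡0 p))
      ∷ from start-21-3 (λ k _ p → <⇒≱ p (letter≤ π (suc k))) ∷ []
      where open Prepend x π x≡

    inv : ∀ x → toℕ x ≡ suc n → Inv (high n) (x ▸ π)
    inv x x≡ = refl , x≡ , (zero , trans (keep (s≤s (letter≤ π zero))) π0≡0) , λ v 0<v v≤n →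
        suc j
      , ≤-<-trans (≤-reflexive (trans (keep (s≤s (letter≤ π (inject₁ j)))) a≡0)) 0<v
      , ≤-trans (s≤s⁻¹ v≤n) (≤-reflexive (sym (trans (keep (s≤s (letter≤ π (suc j)))) b≡n)))
      where open Prepend x π x≡

    -- With the first letter 0 and the later `n`, the letter 0 would form 12-3 and any letter from 1
    -- to `n` would form 21-3.
    only : ∀ x → Fresh patterns x π → toℕ x ≡ suc n
    only x (¬12-3 ∷ _ ∷ _ ∷ ¬21-3 ∷ []) = ≤-antisym (s≤s⁻¹ (toℕ<n x))
      (≰⇒> λ p → to start-21-3 ¬21-3 j
        (≰⇒> λ q → to start-12-3 ¬12-3 j q (subst₂ _<_ (sym π0≡0) (sym b≡n) 0<n))
        (subst (toℕ x ≤_) (sym b≡n) p))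
      where open Prepend x π refl

  module High {n} (π : Permutation′ (suc n)) (0<n : 0 < n) (π0≡n : letter π zero ≡ n)
              {k} (πk≡0 : letter π (suc k) ≡ 0)
              (straddle : ∀ v → 0 < v → v < n → ∃[ j ] letter π (inject₁ j) < v × v ≤ letter π (suc j)) where

    π0≮ : ∀ k → ¬ letter π zero < letter π k
    π0≮ = max≮ π π0≡n

    fresh-0 : ∀ x → toℕ x ≡ 0 → Fresh patterns x π
    fresh-0 x x≡ =
        from start-12-3 (λ k _ → π0≮ (suc k)) ∷ from start-2-13 (λ _ ())
      ∷ from start-32-1 (λ _ _ ()) ∷ from start-21-3 (λ _ ()) ∷ []
      where open Prepend x π x≡

    fresh-n : ∀ x → toℕ x ≡ n → Fresh patterns x π
    fresh-n x x≡ =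
        from start-12-3 (λ k _ → π0≮ (suc k))
      ∷ from start-2-13 (λ j _ p → 0≢1+n (cong toℕ (letter-injective π {zero} {suc j}
          (trans π0≡n (≤-antisym p (letter≤ π (suc j)))))))
      ∷ from start-32-1 (λ _ _ p → <⇒≢ p π0≡n)
      ∷ from start-21-3 (λ _ p _ → <⇒≢ p π0≡n) ∷ []
      where open Prepend x π x≡

    inv-low : ∀ x → toℕ x ≡ 0 → Inv (low n) (x ▸ π)
    inv-low x x≡ = refl , x≡ , zero , x≡ , trans (shift z≤n) (cong suc π0≡n)
      where open Prepend x π x≡

    inv-stuck : ∀ x → toℕ x ≡ n → Inv stuck (x ▸ π)
    inv-stuck x x≡ =
        (zero , subst (_< letter (x ▸ π) (suc zero)) (sym x≡) (from above (≤-reflexive (sym π0≡n))))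
      , (suc k , subst (letter (x ▸ π) (suc (suc k)) <_) (sym x≡)
                   (from below (subst (_< n) (sym πk≡0) 0<n)))
      where open Prepend x π x≡

    -- A letter above `n` would form 32-1 with the first letter `n` and the later 0; the letters
    -- strictly between 0 and `n` are excluded by `straddle`.
    only : ∀ x → Fresh patterns x π → toℕ x ≡ 0 ⊎ toℕ x ≡ n
    only x (_ ∷ ¬2-13 ∷ ¬32-1 ∷ _ ∷ []) with m≤n⇒m<n∨m≡n (z≤n {toℕ x})
    ... | inj₂ 0≡x = inj₁ (sym 0≡x)
    ... | inj₁ 0<x with m≤n⇒m<n∨m≡n x≤n
      where
      open Prepend x π refl
      x≤n : toℕ x ≤ n
      x≤n = ≮⇒≥ λ n<x → to start-32-1 ¬32-1 k (subst₂ _<_ (sym πk≡0) (sym π0≡n) 0<n)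
                          (subst (_< toℕ x) (sym π0≡n) n<x)
    ... | inj₂ x≡n = inj₂ x≡n
    ... | inj₁ x<n with j , a<x , x≤b ← straddle (toℕ x) 0<x x<n =
      contradiction x≤b (to (Prepend.start-2-13 x π refl) ¬2-13 j a<x)

  sound : ∀ s {n} {π : Permutation′ (suc n)} → Inv s π →
    All (Sprout patterns Inv π) (children s)
  sound single {π = π} refl =
    (z≤n , λ x x≡ → fresh x , inv-low x x≡) ∷ (≤-refl , λ x x≡ → fresh x , inv-high x x≡) ∷ []
    where open Single π
  sound (low m) {π = π} (refl , π0≡0 , j , a≡0 , b≡n) =
    (≤-refl , λ x x≡ → fresh x x≡ , inv x x≡) ∷ []
    where open Low π (s≤s z≤n) π0≡0 {j} a≡0 b≡n
  sound (high m) {π = π} (refl , π0≡n , (k , πk≡0) , straddle) =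
    (z≤n , λ x x≡ → fresh-0 x x≡ , inv-low x x≡) ∷
    (n≤1+n _ , λ x x≡ → fresh-n x x≡ , inv-stuck x x≡) ∷ []
    where open High π (s≤s z≤n) π0≡n {k} πk≡0 straddle
  sound stuck _ = []

  complete : ∀ s {n} {π : Permutation′ (suc n)} → Inv s π → ∀ x → Fresh patterns x π →
    toℕ x ∈ map proj₁ (children s)
  complete single refl zero       _ = here refl
  complete single refl (suc zero) _ = there (here refl)
  complete (low m) {π = π} (refl , π0≡0 , j , a≡0 , b≡n) x fr =
    here (Low.only π (s≤s z≤n) π0≡0 {j} a≡0 b≡n x fr)
  complete (high m) {π = π} (refl , π0≡n , (k , πk≡0) , straddle) x fr
    with High.only π (s≤s z≤n) π0≡n {k} πk≡0 straddle x fr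
  ... | inj₁ x≡0 = here x≡0
  ... | inj₂ x≡n = there (here x≡n)
  -- A letter not above the first one forms 12-3 with it and a later larger letter; a letter above
  -- it forms 32-1 with it and a later smaller one.
  complete stuck {π = π} ((k , π0<πk) , (l , πl<π0)) x (¬12-3 ∷ _ ∷ ¬32-1 ∷ _ ∷ []) =
    contradiction (≰⇒> λ p → to start-12-3 ¬12-3 k p π0<πk) (to start-32-1 ¬32-1 l πl<π0)
    where open Prepend x π refl

  unique : ∀ s → Unique (map proj₁ (children s))
  unique single   = ((λ ()) ∷ []) ∷ [] ∷ []
  unique (low m)  = [] ∷ []
  unique (high m) = ((λ ()) ∷ []) ∷ [] ∷ []
  unique stuck    = []

  open GeneratingTree patterns children Inv sound complete unique single refl

  -- One generation exchanges the two labels, and the stuck child has no descendants, so the sum is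
  -- invariant; at the start it is 1 + 2. At least one generation is counted, since a stuck word
  -- still counts itself in generation 0.
  leaves-low+high : ∀ m k l → leaves (suc m) (low k) + leaves (suc m) (high l) ≡ 3
  leaves-low+high zero    k l = refl
  leaves-low+high (suc m) k l = begin
    leaves (suc m) (high (suc k)) + 0 + (leaves (suc m) (low (suc l)) + 0)
      ≡⟨ cong₂ _+_ (+-identityʳ (leaves (suc m) (high (suc k)))) (+-identityʳ (leaves (suc m) (low (suc l)))) ⟩
    leaves (suc m) (high (suc k)) + leaves (suc m) (low (suc l))
      ≡⟨ +-comm (leaves (suc m) (high (suc k))) _ ⟩
    leaves (suc m) (low (suc l)) + leaves (suc m) (high (suc k))
      ≡⟨ leaves-low+high m (suc l) (suc k) ⟩
    3 ∎
    where open ≡-Reasoning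

  count : ∀ m → ∣ S (3 + m) patterns ∣≡ 3
  count m = subst (∣ S (3 + m) patterns ∣≡_)
    (trans (cong (leaves (suc m) (low 0) +_) (+-identityʳ _)) (leaves-low+high m 0 0))
    (∣S∣≡leaves (2 + m))

mainTheorem4 : (∀ (n : ℕ) → n ≥ 1 →
    ∣ S n (⟨ 1 ∙ 2 - 3 ⟩ ∷ ⟨ 1 - 2 ∙ 3 ⟩ ∷ ⟨ 3 ∙ 1 - 2 ⟩ ∷ ⟨ 3 - 1 ∙ 2 ⟩ ∷ []) ∣≡ 1 + (n C 2))
    × (∀ (n : ℕ) → n ≥ 1 →
    ∣ S n (⟨ 1 - 2 ∙ 3 ⟩ ∷ ⟨ 2 ∙ 1 - 3 ⟩ ∷ ⟨ 1 - 3 ∙ 2 ⟩ ∷ ⟨ 1 ∙ 2 - 3 ⟩ ∷ []) ∣≡ n C ⌈ n /2⌉)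
    × (∀ (n : ℕ) → n ≥ 2 →
    ∣ S n (⟨ 1 - 2 ∙ 3 ⟩ ∷ ⟨ 2 ∙ 3 - 1 ⟩ ∷ ⟨ 3 - 1 ∙ 2 ⟩ ∷ ⟨ 1 ∙ 2 - 3 ⟩ ∷ []) ∣≡ 2 ^ (n ∸ 2) + 1)
    × (∀ (n : ℕ) → n ≥ 3 →
    ∣ S n (⟨ 1 ∙ 2 - 3 ⟩ ∷ ⟨ 2 - 1 ∙ 3 ⟩ ∷ ⟨ 3 ∙ 2 - 1 ⟩ ∷ ⟨ 2 ∙ 1 - 3 ⟩ ∷ []) ∣≡ 3)
mainTheorem4 =
    (λ { (suc m) _ → Class₁.count m })
  , (λ { (suc m) _ → Class₂.count m })
  , (λ { (suc (suc m)) _ → Class₃.count m ; (suc zero) (s≤s ()) })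
  , (λ { (suc (suc (suc m))) _ → Class₄.count m ; (suc zero) (s≤s ()) ; (suc (suc zero)) (s≤s (s≤s ())) })
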